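{- Let $\lambda=\langle1^{m_1},2^{m_2},\dots,k^{m_k}\rangle$ with all $m_i>0$, $n\ge1$, $x_1,\dots,x_n>0$, $t>0$. For $1\le j\le k$ let $M_j=m_j+\dots+m_k$ and $M_{k+1}=0$. Under the stationary distribution of the mTAZRP of type $\lambda$ on $n$ sites, the expected number of particles of species $j$ at site $1$ is $$\langle\tau^{(j)}_1\rangle=x_1\frac{\partial}{\partial x_1}\log\left(\frac{\widetilde H_{\langle1^{M_j}\rangle}(x_1,\dots,x_n;1,t)}{\widetilde H_{\langle1^{M_{j+1}}\rangle}(x_1,\dots,x_n;1,t)}\right),$$ with $\widetilde H_{\langle1^0\rangle}:=1$.
   Context: mTAZRP: for a partition $\lambda$ and $n\ge1$, sites $1,\dots,n$ on a ring (site $n+1$ is site $1$); a configuration assigns to each site a multiset of species with union the multiset of parts of $\lambda$; if site $j$ has $c$ particles of species $r$ and $d$ of species larger than $r$, a particle of species $r$ jumps from $j$ to $j+1$ at rate $x_j^{ -1}t^d(1+t+\dots+t^{c-1})$. $\langle1^{m_1},\dots,k^{m_k}\rangle$ denotes the partition with part $i$ occurring $m_i$ times. Notation: $[a]_t=1+t+\dots+t^{a-1}$, $[a]_t!=\prod_{b\le a}[b]_t$, $\begin{bmatrix}m\\ \eta_1,\dots,\eta_n\end{bmatrix}_t=[m]_t!/\prod_i[\eta_i]_t!$, and $\widetilde H_{\langle1^m\rangle}(x_1,\dots,x_n;1,t)=\sum_{\eta_1+\dots+\eta_n=m,\ \eta_i\ge0}\begin{bmatrix}m\\ \eta_1,\dots,\eta_n\end{bmatrix}_t\prod_i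 x_i^{\eta_i}$. -}

module Defs where

open import Level using (Level; _⊔_) renaming (suc to lsuc)
open import Data.Nat.Base as ℕ using (ℕ; zero; suc; pred; s≤s)
import Data.Nat.Properties as ℕₚ
open import Data.Nat.DivMod using (_mod_)
open import Data.Bool.Base using (if_then_else_)
open import Data.Fin.Base using (Fin; zero; suc; toℕ)
import Data.Fin.Properties as Finₚ
open import Data.List.Base as List using (List; []; _∷_)
open import Data.List.Membership.Propositional using (_∈_)
open import Data.List.Membership.Propositional.Properties
  using (∈-filter⁺; ∈-filter⁻; ∈-cartesianProductWith⁺; ∈-upTo⁺)
open import Data.List.Relation.Unary.Any using (here)
open import Data.List.Relation.Unary.AllPairs using ([]; _∷_)
import Data.List.Relation.Unary.All as ListAll
open import Data.List.Relation.Unary.Unique.Propositional using (Unique)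
import Data.List.Relation.Unary.Unique.Propositional.Properties as Uniqueₚ
open import Data.Vec.Base as Vec using (Vec; []; _∷_)
import Data.Vec.Properties as Vecₚ
open import Data.Vec.Relation.Unary.All using (All; []; _∷_)
import Data.Vec.Relation.Unary.All as VecAll
open import Data.Vec.Relation.Binary.Pointwise.Inductive using (Pointwise; []; _∷_)
open import Data.Vec.Functional as VF using (Vector)
import Data.Vec.Functional.Properties as VFₚ
open import Data.Product.Base using (_×_; _,_; proj₁; proj₂; ∃-syntax)
open import Data.Sum.Base using (_⊎_; inj₁; inj₂)
open import Function.Base using (const; _∘_)
open import Function.Bundles using (_⇔_; mk⇔; Equivalence)
open import Relation.Nullary using (¬_; does; yes; no; contradiction)
open import Relation.Binary.Core using (Rel)
open import Relation.Binary.Definitions using (DecidableEquality)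
open import Relation.Binary.Structures using (IsStrictPartialOrder)
open import Relation.Binary.Lattice.Definitions using (Supremum)
open import Relation.Binary.PropositionalEquality as ≡ using (_≡_)
open import Algebra.Core using (Op₂)
open import Algebra.Bundles using (CommutativeRing; Semiring)
open import Algebra.Apartness.Bundles using (HeytingField)
import Algebra.Definitions.RawSemiring as RawSemiringDefs
import Algebra.Properties.Ring as RingProperties
import Algebra.Apartness.Properties.HeytingCommutativeRing as HCRProperties

private
  variable
    a c ℓ₁ ℓ₂ : Level
    A : Set a
    k n : ℕ

------------------------------------------------------------------------
-- Combinatorics

tuples : (n : ℕ) → List A → List (Vec A n)
tuples zero    xs = [] ∷ []
tuples (suc n) xs = List.cartesianProductWith _∷_ xs (tuples n xs)

∈-tuples⁺ : {xs : List A} {v : Vec A n} → All (_∈ xs) v → v ∈ tuples n xs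
∈-tuples⁺ []       = here ≡.refl
∈-tuples⁺ (p ∷ ps) = ∈-cartesianProductWith⁺ _∷_ p (∈-tuples⁺ ps)

tuples-unique : ∀ n {xs : List A} → Unique xs → Unique (tuples n xs)
tuples-unique zero    u = ListAll.[] ∷ []
tuples-unique (suc n) u =
  Uniqueₚ.cartesianProductWith⁺ _∷_ Vecₚ.∷-injective u (tuples-unique n u)

compositions : (n m : ℕ) → List (Vec ℕ n)
compositions n m =
  List.filter (λ η → Vec.sum η ℕₚ.≟ m) (tuples n (List.upTo (suc m)))

sum-bound : (v : Vec ℕ n) → All (ℕ._≤ Vec.sum v) v
sum-bound []      = []
sum-bound (x ∷ v) =
  ℕₚ.m≤m+n x (Vec.sum v) ∷
  VecAll.map (λ p → ℕₚ.≤-trans p (ℕₚ.m≤n+m (Vec.sum v) x)) (sum-bound v)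

∈-compositions : ∀ {m} {η : Vec ℕ n} → η ∈ compositions n m ⇔ Vec.sum η ≡ m
∈-compositions {n} {m} {η} = mk⇔
  (λ p → proj₂ (∈-filter⁻ (λ η → Vec.sum η ℕₚ.≟ m)
                          {xs = tuples n (List.upTo (suc m))} p))
  from
  where
  from : Vec.sum η ≡ m → η ∈ compositions n m
  from ≡.refl = ∈-filter⁺ (λ η → Vec.sum η ℕₚ.≟ m)
    (∈-tuples⁺ (VecAll.map (λ p → ∈-upTo⁺ (s≤s p)) (sum-bound η))) ≡.refl

compositions-unique : ∀ n m → Unique (compositions n m)
compositions-unique n m =
  Uniqueₚ.filter⁺ (λ η → Vec.sum η ℕₚ.≟ m) (tuples-unique n (Uniqueₚ.upTo⁺ (suc m)))

-- A multiset of species is the vector of its multiplicities; index r : Fin k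
-- is the species r + 1.

Multiset : ℕ → Set
Multiset k = Vec ℕ k

-- Number of elements of index at least i (none when i = k).

atLeast : Multiset k → Fin (suc k) → ℕ
atLeast m       zero    = Vec.sum m
atLeast (_ ∷ m) (suc i) = atLeast m i

_⊎ᵐ_ : Multiset k → Multiset k → Multiset k
_⊎ᵐ_ = Vec.zipWith ℕ._+_

⋃ᵐ : Vec (Multiset k) n → Multiset k
⋃ᵐ = Vec.foldr′ _⊎ᵐ_ (Vec.replicate _ 0)

submultisets : Multiset k → List (Multiset k)
submultisets []       = [] ∷ []
submultisets (m ∷ ms) =
  List.cartesianProductWith _∷_ (List.upTo (suc m)) (submultisets ms)

_≟ᵐ_ : DecidableEquality (Multiset k)
_≟ᵐ_ = Vecₚ.≡-dec ℕₚ._≟_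

Config : (n k : ℕ) → Set
Config n k = Vec (Multiset k) n

configs : (n : ℕ) → Multiset k → List (Config n k)
configs n m = List.filter (λ c → ⋃ᵐ c ≟ᵐ m) (tuples n (submultisets m))

∈-submultisets⁺ : {u m : Multiset k} → Pointwise ℕ._≤_ u m → u ∈ submultisets m
∈-submultisets⁺ []       = here ≡.refl
∈-submultisets⁺ (p ∷ ps) =
  ∈-cartesianProductWith⁺ _∷_ (∈-upTo⁺ (s≤s p)) (∈-submultisets⁺ ps)

submultisets-unique : (m : Multiset k) → Unique (submultisets m)
submultisets-unique []       = ListAll.[] ∷ []
submultisets-unique (m ∷ ms) =
  Uniqueₚ.cartesianProductWith⁺ _∷_ Vecₚ.∷-injective
    (Uniqueₚ.upTo⁺ (suc m)) (submultisets-unique ms)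

⊎ᵐ-boundˡ : (u v : Multiset k) → Pointwise ℕ._≤_ u (u ⊎ᵐ v)
⊎ᵐ-boundˡ []      []      = []
⊎ᵐ-boundˡ (x ∷ u) (y ∷ v) = ℕₚ.m≤m+n x y ∷ ⊎ᵐ-boundˡ u v

⊎ᵐ-boundʳ : {w : Multiset k} (u v : Multiset k) →
            Pointwise ℕ._≤_ w v → Pointwise ℕ._≤_ w (u ⊎ᵐ v)
⊎ᵐ-boundʳ []      []      []       = []
⊎ᵐ-boundʳ (x ∷ u) (y ∷ v) (p ∷ ps) =
  ℕₚ.≤-trans p (ℕₚ.m≤n+m y x) ∷ ⊎ᵐ-boundʳ u v ps

⋃ᵐ-bound : (c : Config n k) → All (λ u → Pointwise ℕ._≤_ u (⋃ᵐ c)) c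
⋃ᵐ-bound []      = []
⋃ᵐ-bound (u ∷ c) =
  ⊎ᵐ-boundˡ u (⋃ᵐ c) ∷ VecAll.map (⊎ᵐ-boundʳ u (⋃ᵐ c)) (⋃ᵐ-bound c)

∈-configs : ∀ {m : Multiset k} {c : Config n k} → c ∈ configs n m ⇔ ⋃ᵐ c ≡ m
∈-configs {n = n} {m} {c} = mk⇔
  (λ p → proj₂ (∈-filter⁻ (λ c → ⋃ᵐ c ≟ᵐ m)
                          {xs = tuples n (submultisets m)} p))
  from
  where
  from : ⋃ᵐ c ≡ m → c ∈ configs n m
  from ≡.refl = ∈-filter⁺ (λ c → ⋃ᵐ c ≟ᵐ m)
    (∈-tuples⁺ (VecAll.map ∈-submultisets⁺ (⋃ᵐ-bound c))) ≡.refl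

configs-unique : ∀ n (m : Multiset k) → Unique (configs n m)
configs-unique n m =
  Uniqueₚ.filter⁺ (λ c → ⋃ᵐ c ≟ᵐ m) (tuples-unique n (submultisets-unique m))

------------------------------------------------------------------------
-- The real numbers, axiomatised as a Cauchy complete Archimedean ordered
-- field.  The axioms avoid trichotomy, so they hold constructively, and they
-- determine the field up to isomorphism.

record RealField c ℓ₁ ℓ₂ : Set (lsuc (c ⊔ ℓ₁ ⊔ ℓ₂)) where
  infix  4 _<_ _≤_
  infixl 6 _∨_
  field
    heytingField : HeytingField c ℓ₁ ℓ₂

  open HeytingField heytingField public

  commutativeRing : CommutativeRing c ℓ₁
  commutativeRing = record { isCommutativeRing = isCommutativeRing }

  open CommutativeRing commutativeRing public using (ring; semiring)
  open RawSemiringDefs (Semiring.rawSemiring semiring) public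
    using (_^_; sum; product) renaming (_×_ to _·_)

  field
    _<_                    : Rel Carrier ℓ₂
    _∨_                    : Op₂ Carrier
    <-isStrictPartialOrder : IsStrictPartialOrder _≈_ _<_
    #⇔<⊎>                  : ∀ {x y} → x # y ⇔ (x < y ⊎ y < x)
    +-monoʳ-<              : ∀ x {y z} → y < z → x + y < x + z
    *-pos                  : ∀ {x y} → 0# < x → 0# < y → 0# < x * y

  open IsStrictPartialOrder <-isStrictPartialOrder public
    using (<-resp-≈; <-respˡ-≈; <-respʳ-≈)
    renaming (trans to <-trans; irrefl to <-irrefl; asym to <-asym)

  _≤_ : Rel Carrier ℓ₂
  x ≤ y = ¬ (y < x)

  ∣_∣ : Carrier → Carrier
  ∣ x ∣ = x ∨ (- x)

  field
    ∨-supremum  : Supremum _≤_ _∨_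
    archimedean : ∀ x → ∃[ n ] x < n · 1#
    complete    : (s : ℕ → Carrier) →
      (∀ ε → 0# < ε →
        ∃[ N ] (∀ p q → N ℕ.≤ p → N ℕ.≤ q → ∣ s p - s q ∣ < ε)) →
      ∃[ l ] (∀ ε → 0# < ε → ∃[ N ] (∀ p → N ℕ.≤ p → ∣ s p - l ∣ < ε))

module Reals (R : RealField c ℓ₁ ℓ₂) where
  open RealField R hiding (zero; Carrier; _≈_; _<_; _*_; 0#)
  open RealField R public using (Carrier; _≈_; _<_; _*_; 0#)
  open RingProperties ring using (-1*x≈-x; -‿involutive; -‿distribʳ-*)
  open HCRProperties (HeytingField.heytingCommutativeRing heytingField)
    using (1#0; x-0≈x)

  x<0⇒0<-x : ∀ {x} → x < 0# → 0# < - x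
  x<0⇒0<-x {x} x<0 =
    <-respˡ-≈ (-‿inverseˡ x) (<-respʳ-≈ (+-identityʳ (- x)) (+-monoʳ-< (- x) x<0))

  0<1 : 0# < 1#
  0<1 with Equivalence.to #⇔<⊎> 1#0
  ... | inj₂ 0<1# = 0<1#
  ... | inj₁ 1<0  = <-respʳ-≈ (trans (-1*x≈-x (- 1#)) (-‿involutive 1#))
                      (*-pos (x<0⇒0<-x 1<0) (x<0⇒0<-x 1<0))

  +-pos : ∀ {x y} → 0# < x → 0# < y → 0# < x + y
  +-pos {x} {y} 0<x 0<y =
    <-trans 0<x (<-respˡ-≈ (+-identityʳ x) (+-monoʳ-< x 0<y))

  private
    pos⇒# : ∀ {x} → 0# < x → x # 0#
    pos⇒# 0<x = Equivalence.from #⇔<⊎> (inj₂ 0<x)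

  -- The library inverts x - 0# rather than x, see recip-inverse.

  recip : ∀ {x} → 0# < x → Carrier
  recip 0<x = proj₁ (#⇒invertible (pos⇒# 0<x))

  recip-inverse : ∀ {x} (0<x : 0# < x) → x * recip 0<x ≈ 1#
  recip-inverse {x} 0<x = trans (*-congʳ (sym (x-0≈x x)))
    (proj₂ (proj₂ (#⇒invertible (pos⇒# 0<x))))

  recip-pos : ∀ {x} (0<x : 0# < x) → 0# < recip 0<x
  recip-pos {x} 0<x with Equivalence.to #⇔<⊎> recip#0
    where
    recip#0 : recip 0<x # 0#
    recip#0 = invertible⇒#
      ( x
      , trans (*-congˡ (x-0≈x _)) (recip-inverse 0<x)
      , trans (*-congʳ (x-0≈x _)) (trans (*-comm _ _) (recip-inverse 0<x)))
  ... | inj₂ 0<r = 0<r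
  ... | inj₁ r<0 = contradiction
        (<-respʳ-≈ (-‿inverseʳ 1#) (+-pos 0<1 0<-1)) (<-irrefl refl)
    where
    0<-1 : 0# < - 1#
    0<-1 = <-respʳ-≈
      (trans (sym (-‿distribʳ-* x (recip 0<x))) (-‿cong (recip-inverse 0<x)))
      (*-pos 0<x (x<0⇒0<-x r<0))

  ^-pos : ∀ {x} → 0# < x → ∀ n → 0# < x ^ n
  ^-pos 0<x zero    = 0<1
  ^-pos 0<x (suc n) = *-pos 0<x (^-pos 0<x n)

  sum-pos : (f : Vector Carrier (suc n)) → (∀ i → 0# < f i) → 0# < sum f
  sum-pos {zero}  f f>0 = <-respʳ-≈ (sym (+-identityʳ _)) (f>0 zero)
  sum-pos {suc n} f f>0 = +-pos (f>0 zero) (sum-pos (VF.tail f) (f>0 ∘ suc))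

  product-pos : (f : Vector Carrier n) → (∀ i → 0# < f i) → 0# < product f
  product-pos {zero}  f f>0 = 0<1
  product-pos {suc n} f f>0 = *-pos (f>0 zero) (product-pos (VF.tail f) (f>0 ∘ suc))

  Σ[_] : {A : Set} → List A → (A → Carrier) → Carrier
  Σ[ xs ] f = List.foldr (λ x s → f x + s) 0# xs

  Σ-pos : {A : Set} {x : A} (xs : List A) (f : A → Carrier) → x ∈ xs →
          (∀ y → 0# < f y) → 0# < Σ[ xs ] f
  Σ-pos (x ∷ [])     f _ f>0 = <-respʳ-≈ (sym (+-identityʳ _)) (f>0 x)
  Σ-pos (x ∷ y ∷ xs) f _ f>0 = +-pos (f>0 x) (Σ-pos (y ∷ xs) f (here ≡.refl) f>0)

  ----------------------------------------------------------------------
  -- Derivatives of functions on the positive half-line and the positive orthant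

  Positive : Vector Carrier n → Set ℓ₂
  Positive x = ∀ i → 0# < x i

  HasDerivativeAt : (f : ∀ y → 0# < y → Carrier) →
                    ∀ x → 0# < x → Carrier → Set (c ⊔ ℓ₂)
  HasDerivativeAt f x x>0 D =
    ∀ ε → 0# < ε → ∃[ δ ] (0# < δ × (∀ y y>0 → ∣ y - x ∣ < δ →
      ∣ f y y>0 - f x x>0 - D * (y - x) ∣ ≤ ε * ∣ y - x ∣))

  _[_≔_] : Vector Carrier n → Fin n → Carrier → Vector Carrier n
  x [ i ≔ y ] = VF.updateAt x i (const y)

  ≔-positive : {x : Vector Carrier n} (i : Fin n) {y : Carrier} →
               Positive x → 0# < y → Positive (x [ i ≔ y ])
  ≔-positive {x = x} i x>0 y>0 j with j Finₚ.≟ i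
  ... | yes ≡.refl = ≡.subst (0# <_) (≡.sym (VFₚ.updateAt-updates i x)) y>0
  ... | no  j≢i    = ≡.subst (0# <_) (≡.sym (VFₚ.updateAt-minimal j i x j≢i)) (x>0 j)

  HasPartialDerivativeAt : (F : (x : Vector Carrier n) → Positive x → Carrier) →
    Fin n → (x : Vector Carrier n) → Positive x → Carrier → Set (c ⊔ ℓ₂)
  HasPartialDerivativeAt F i x x>0 D =
    HasDerivativeAt (λ y y>0 → F (x [ i ≔ y ]) (≔-positive i x>0 y>0))
                    (x i) (x>0 i) D

  -- The natural logarithm is the homomorphism from the positive numbers under
  -- multiplication to the additive group with derivative 1/x.  It is unique:
  -- the difference h of two of them has derivative 0 at 1 and satisfies
  -- h x ≈ n · h (x^(1/n)).

  record IsLog (log : ∀ x → 0# < x → Carrier) : Set (c ⊔ ℓ₁ ⊔ ℓ₂) where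
    field
      log-*          : ∀ x y (x>0 : 0# < x) (y>0 : 0# < y) →
                       log (x * y) (*-pos x>0 y>0) ≈ log x x>0 + log y y>0
      log-derivative : ∀ x (x>0 : 0# < x) → HasDerivativeAt log x x>0 (recip x>0)

  ----------------------------------------------------------------------
  -- Stationary distributions of finite continuous-time Markov chains.
  -- q s s′ is the rate from s to s′; diagonal entries of q, which are nonzero
  -- for jumps on a one-site ring, cancel in the balance equation.

  record IsStationary {S : Set} (states : List S) (q : S → S → Carrier)
                      (π : S → Carrier) : Set (c ⊔ ℓ₁ ⊔ ℓ₂) where
    field
      nonnegative : ∀ {s} → s ∈ states → 0# ≤ π s
      normalised  : Σ[ states ] π ≈ 1#
      balance     : ∀ {s} → s ∈ states →
        (Σ[ states ] λ s′ → π s′ * q s′ s) ≈ π s * (Σ[ states ] λ s′ → q s s′)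

  ----------------------------------------------------------------------
  -- t-analogues and the polynomials H̃ of a one-column type

  module TAnalogues {t : Carrier} (t>0 : 0# < t) where

    [_]ₜ : ℕ → Carrier
    [ m ]ₜ = sum {m} λ i → t ^ toℕ i

    [_]ₜ! : ℕ → Carrier
    [ m ]ₜ! = product {m} λ i → [ suc (toℕ i) ]ₜ

    [_]ₜ!-pos : ∀ m → 0# < [ m ]ₜ!
    [ m ]ₜ!-pos =
      product-pos {m} _ λ i → sum-pos {toℕ i} _ λ j → ^-pos t>0 (toℕ j)

    product-!-pos : (η : Vec ℕ n) → 0# < product λ i → [ Vec.lookup η i ]ₜ!
    product-!-pos η = product-pos _ λ i → [ Vec.lookup η i ]ₜ!-pos

    multinomial : ℕ → Vec ℕ n → Carrier
    multinomial m η = [ m ]ₜ! * recip (product-!-pos η)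

    -- H̃ m x is the polynomial of type ⟨1ᵐ⟩ at (x; 1, t).

    H̃ : ℕ → Vector Carrier n → Carrier
    H̃     zero      x = 1#
    H̃ {n} m@(suc _) x = Σ[ compositions n m ] λ η →
      multinomial m η * product λ i → x i ^ Vec.lookup η i

    H̃-pos : ∀ m {x : Vector Carrier (suc n)} → Positive x → 0# < H̃ m x
    H̃-pos     zero      x>0 = 0<1
    H̃-pos {n} m@(suc _) x>0 =
      Σ-pos _ _ (Equivalence.from (∈-compositions {η = m ∷ Vec.replicate n 0}) sum-≡) λ η →
        *-pos (*-pos [ m ]ₜ!-pos (recip-pos (product-!-pos η)))
              (product-pos _ λ i → ^-pos (x>0 i) (Vec.lookup η i))
      where
      sum-replicate-0 : ∀ n → Vec.sum (Vec.replicate n 0) ≡ 0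
      sum-replicate-0 zero    = ≡.refl
      sum-replicate-0 (suc n) = sum-replicate-0 n

      sum-≡ : Vec.sum (m ∷ Vec.replicate n 0) ≡ m
      sum-≡ = ≡.trans (≡.cong (m ℕ.+_) (sum-replicate-0 n)) (ℕₚ.+-identityʳ m)

    H̃-ratio : (m m′ : ℕ) (x : Vector Carrier (suc n)) → Positive x → Carrier
    H̃-ratio m m′ x x>0 = H̃ m x * recip (H̃-pos m′ x>0)

    H̃-ratio-pos : ∀ m m′ {x : Vector Carrier (suc n)} (x>0 : Positive x) →
                  0# < H̃-ratio m m′ x x>0
    H̃-ratio-pos m m′ x>0 = *-pos (H̃-pos m x>0) (recip-pos (H̃-pos m′ x>0))

    --------------------------------------------------------------------
    -- The multispecies totally asymmetric zero range process; sites are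
    -- Fin (suc n), site 1 being zero.

    next : Fin (suc n) → Fin (suc n)
    next {n} j = suc (toℕ j) mod suc n

    module TAZRP {n k : ℕ} {x : Vector Carrier (suc n)} (x>0 : Positive x) where

      count : Config (suc n) k → Fin (suc n) → Fin k → ℕ
      count c j r = Vec.lookup (Vec.lookup c j) r

      larger : Config (suc n) k → Fin (suc n) → Fin k → ℕ
      larger c j r = atLeast (Vec.lookup c j) (suc r)

      -- Meaningful only if count c j r is nonzero; otherwise jumpRate c j r
      -- vanishes.

      jump : Config (suc n) k → Fin (suc n) → Fin k → Config (suc n) k
      jump c j r =
        Vec.updateAt (Vec.updateAt c j (λ u → Vec.updateAt u r pred))
                     (next j) (λ u → Vec.updateAt u r suc)

      jumpRate : Config (suc n) k → Fin (suc n) → Fin k → Carrier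
      jumpRate c j r = recip (x>0 j) * t ^ larger c j r * [ count c j r ]ₜ

      rate : Config (suc n) k → Config (suc n) k → Carrier
      rate c c′ = sum λ j → sum λ r →
        if does (Vecₚ.≡-dec _≟ᵐ_ (jump c j r) c′) then jumpRate c j r else 0#

      IsStationaryTAZRP : Multiset k → (Config (suc n) k → Carrier) → Set (c ⊔ ℓ₁ ⊔ ℓ₂)
      IsStationaryTAZRP m π = IsStationary (configs (suc n) m) rate π

      expectation : Multiset k → (Config (suc n) k → Carrier) →
                    (Config (suc n) k → ℕ) → Carrier
      expectation m π N = Σ[ configs (suc n) m ] λ c → N c · π c

{-# OPTIONS --safe #-}

-- For a threshold species i, the particles of species at least i form a single
-- species zero range process: the rates t^d [c]ₜ of these species at a site
-- add up to [η]ₜ, where η is the number of such particles there.  Its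
-- stationary distribution is proportional to w η = ∏ xⱼ^ηⱼ / [ηⱼ]ₜ!, so that
-- the mean of η₁ is x₁ ∂₁ log H̃, and the theorem is the difference of these
-- means for two consecutive thresholds.
--
-- For the uniqueness, write a stationary distribution as f w.  A jump from
-- site j starts at some ζ + eⱼ and has w (ζ + eⱼ) xⱼ⁻¹ [ζⱼ + 1]ₜ = w ζ, so
-- testing stationarity against f itself gives
-- Σ_ζ w ζ Σ_j (f (ζ + eⱼ₊₁) - f (ζ + eⱼ))² = 0, and f is constant.
-- No case distinction on real numbers is needed, because ≈ is stable under
-- double negation.

module Submission where

open import Level using (Level)
open import Data.Nat.Base as ℕ using (ℕ; zero; suc; pred)
import Data.Nat.Properties as ℕₚ
import Data.Nat.DivMod as DivMod
open import Data.Bool.Base using (Bool; true; false; if_then_else_)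
open import Data.Empty using (⊥-elim)
open import Data.Fin.Base using (Fin; zero; suc; inject₁; fromℕ; toℕ)
import Data.Fin.Properties as Finₚ
import Data.Fin.Induction as FinInduction
open import Data.List.Base using (List; []; _∷_)
open import Data.List.Membership.Propositional using (_∈_)
import Data.List.Relation.Unary.All as ListAll
open import Data.List.Relation.Unary.AllPairs using ([]; _∷_)
open import Data.List.Relation.Unary.Any using (here; there)
open import Data.List.Relation.Unary.Unique.Propositional using (Unique)
import Data.Maybe.Base as Maybe
open import Data.Product.Base using (_×_; _,_; proj₁; proj₂; ∃-syntax)
open import Data.Sum.Base using (_⊎_; inj₁; inj₂)
open import Data.Vec.Base as Vec using (Vec; []; _∷_; lookup; updateAt)
import Data.Vec.Properties as Vecₚ
open import Data.Vec.Functional using (Vector)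
open import Data.Vec.Relation.Unary.All using (All)
open import Function.Base using (_∘_; case_of_)
open import Function.Bundles using (_⇔_; Equivalence)
open import Relation.Nullary using (¬_; Dec; does; contradiction)
open import Relation.Nullary.Decidable using (dec⇒maybe; dec-true; dec-false; yes; no)
open import Relation.Binary.Definitions using (DecidableEquality)
open import Relation.Binary.PropositionalEquality as ≡ using (_≡_; _≢_)
import Relation.Binary.Reasoning.Base.Triple
import Relation.Binary.Reasoning.Setoid
open import Relation.Binary.Structures using (IsPreorder)
open import Algebra.Bundles using (RawRing; CommutativeRing)
import Algebra.Properties.AbelianGroup
import Algebra.Properties.CommutativeSemigroup
import Algebra.Properties.Monoid.Sum
import Algebra.Properties.Ring
import Algebra.Properties.Semiring.Mult
import Algebra.Properties.Semiring.Sum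
import Algebra.Solver.Ring
open import Algebra.Solver.Ring.AlmostCommutativeRing
  using (fromCommutativeRing; _-Raw-AlmostCommutative⟶_)
open import Defs

-- Ring identities

-- Stationarity is used only in weak form: the sum of `π c` times `L g c` vanishes for every test
-- function `g`, where `L` is the generator. Lumping is then the substitution of `G ∘ lump i` for
-- `g`, and the resulting identity for the pushforward may be tested against the density of the
-- pushforward itself.
--
-- The sum of squares closes up because one weight `w ζ` multiplies all the jumps out of the
-- configurations `ζ + eⱼ`: the rate of leaving site `j` is exactly the ratio of two weights, so
-- neither `xⱼ` nor the occupation of the site survives, and the sum over `j` runs once around the
-- ring. Connectedness comes from the same `ζ`: all `ζ + eⱼ` share one density, so particles can be
-- collected on the first site without changing it.
--
-- The factor of proportionality is fixed by total mass one, which makes it `[ M ]ₜ!` divided by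
-- `H̃`. Since `x₁ ∂₁` multiplies a monomial by its exponent `η₁`, the mean becomes a logarithmic
-- derivative.
--
-- The function `log` is only known through `IsLog`, which does not say that it respects `≈`; this
-- has to be extracted from its differentiability.

module IntegerSolver {r ℓ} (R : CommutativeRing r ℓ) where
  open CommutativeRing R
  open Algebra.Properties.Semiring.Mult semiring
    using () renaming (_×_ to _·_; ×-homo-+ to ·-homo-+; ×1-homo-* to ·1-homo-*)
  open Algebra.Properties.Ring ring
    using (-‿distribˡ-*; -‿distribʳ-*; -‿involutive; -0#≈0#; x≈y⇒x∙y⁻¹≈ε; x∙y⁻¹≈ε⇒x≈y)
  open Algebra.Properties.AbelianGroup +-abelianGroup
    using (⁻¹-∙-comm; ⁻¹-anti-homo‿-)
  open Algebra.Properties.CommutativeSemigroup +-commutativeSemigroup using (interchange)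
  open Relation.Binary.Reasoning.Setoid setoid

  -- The integer a - b is represented by the pair (a , b).  The solver compares
  -- coefficients syntactically, hence the reduction to a ≡ 0 or b ≡ 0.
  reduce : ℕ × ℕ → ℕ × ℕ
  reduce (a , b) = a ℕ.∸ b , b ℕ.∸ a

  -- Cancelling terms needs coefficients with decidable equality, which the carrier of `R` does not
  -- offer. Elements of `R`, even `1#`, enter the solver as variables.
  differences : RawRing _ _
  differences = record
    { Carrier = ℕ × ℕ
    ; _≈_     = _≡_
    ; _+_     = λ (a , b) (c , d) → reduce (a ℕ.+ c , b ℕ.+ d)
    ; _*_     = λ (a , b) (c , d) → reduce (a ℕ.* c ℕ.+ b ℕ.* d , a ℕ.* d ℕ.+ b ℕ.* c)
    ; -_      = λ (a , b) → b , a
    ; 0#      = 0 , 0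
    ; 1#      = 1 , 0
    }

  ⟦_⟧ : ℕ × ℕ → Carrier
  ⟦ a , b ⟧ = a · 1# - b · 1#

  -‿interchange : ∀ x y z w → (x + y) - (z + w) ≈ (x - z) + (y - w)
  -‿interchange x y z w =
    trans (+-congˡ (sym (⁻¹-∙-comm z w))) (interchange x y (- z) (- w))

  -‿*-expand : ∀ x y z w → (x - y) * (z - w) ≈ (x * z + y * w) - (x * w + y * z)
  -‿*-expand x y z w = begin
    (x - y) * (z - w)                             ≈⟨ distribʳ _ _ _ ⟩
    x * (z - w) + - y * (z - w)                   ≈⟨ +-cong (distribˡ _ _ _) (distribˡ _ _ _) ⟩
    (x * z + x * - w) + (- y * z + - y * - w)
      ≈⟨ +-cong (+-congˡ (-‿distribʳ-* x w)) (trans (+-comm _ _) (+-cong (-‿distribˡ-* y z) y*w≈)) ⟨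
    (x * z - x * w) + (y * w - y * z)             ≈⟨ -‿interchange _ _ _ _ ⟨
    (x * z + y * w) - (x * w + y * z)             ∎
    where
    y*w≈ : y * w ≈ - y * - w
    y*w≈ = begin
      y * w        ≈⟨ -‿involutive (y * w) ⟨
      - - (y * w)  ≈⟨ -‿cong (-‿distribʳ-* y w) ⟩
      - (y * - w)  ≈⟨ -‿distribˡ-* y (- w) ⟩
      - y * - w    ∎

  -- The equality of two differences is written additively to stay within the natural numbers. It
  -- serves both `⟦reduce⟧` and the comparison of coefficients in the solver.
  ⟦⟧-cong : ∀ p q → proj₁ p ℕ.+ proj₂ q ≡ proj₁ q ℕ.+ proj₂ p → ⟦ p ⟧ ≈ ⟦ q ⟧
  ⟦⟧-cong (a , b) (c , d) eq = x∙y⁻¹≈ε⇒x≈y _ _ (begin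
    ⟦ a , b ⟧ - ⟦ c , d ⟧             ≈⟨ +-congˡ (⁻¹-anti-homo‿- _ _) ⟩
    ⟦ a , b ⟧ + ⟦ d , c ⟧             ≈⟨ -‿interchange _ _ _ _ ⟨
    (a · 1# + d · 1#) - (b · 1# + c · 1#)
      ≈⟨ x≈y⇒x∙y⁻¹≈ε (begin
           a · 1# + d · 1#  ≈⟨ ·-homo-+ 1# a d ⟨
           (a ℕ.+ d) · 1#   ≡⟨ ≡.cong (_· 1#) eq ⟩
           (c ℕ.+ b) · 1#   ≈⟨ ·-homo-+ 1# c b ⟩
           c · 1# + b · 1#  ≈⟨ +-comm _ _ ⟩
           b · 1# + c · 1#  ∎) ⟩
    0# ∎)

  -- Both sides are the maximum of `a` and `b`.
  ∸-+-swap : ∀ a b → a ℕ.∸ b ℕ.+ b ≡ a ℕ.+ (b ℕ.∸ a)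
  ∸-+-swap zero    zero    = ≡.refl
  ∸-+-swap zero    (suc b) = ≡.refl
  ∸-+-swap (suc a) zero    = ≡.refl
  ∸-+-swap (suc a) (suc b) = ≡.trans (ℕₚ.+-suc _ b) (≡.cong suc (∸-+-swap a b))

  ⟦reduce⟧ : ∀ p → ⟦ reduce p ⟧ ≈ ⟦ p ⟧
  ⟦reduce⟧ p@(a , b) = ⟦⟧-cong (reduce p) p (∸-+-swap a b)

  morphism : differences -Raw-AlmostCommutative⟶ fromCommutativeRing R
  morphism = record
    { ⟦_⟧    = ⟦_⟧
    ; +-homo = λ (a , b) (c , d) → trans (⟦reduce⟧ (a ℕ.+ c , b ℕ.+ d)) (trans
        (+-cong (·-homo-+ 1# a c) (-‿cong (·-homo-+ 1# b d))) (-‿interchange _ _ _ _))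
    ; *-homo = λ (a , b) (c , d) → trans (⟦reduce⟧ (a ℕ.* c ℕ.+ b ℕ.* d , a ℕ.* d ℕ.+ b ℕ.* c)) (trans
        (+-cong (trans (·-homo-+ 1# (a ℕ.* c) (b ℕ.* d)) (+-cong (·1-homo-* a c) (·1-homo-* b d)))
                (-‿cong (trans (·-homo-+ 1# (a ℕ.* d) (b ℕ.* c)) (+-cong (·1-homo-* a d) (·1-homo-* b c)))))
        (sym (-‿*-expand _ _ _ _)))
    ; -‿homo = λ (a , b) → sym (⁻¹-anti-homo‿- _ _)
    ; 0-homo = -‿inverseʳ 0#
    ; 1-homo = trans (+-cong (+-identityʳ 1#) -0#≈0#) (+-identityʳ 1#)
    }

  open Algebra.Solver.Ring differences (fromCommutativeRing R) morphism
    (λ p q → Maybe.map (⟦⟧-cong p q)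
                       (dec⇒maybe (proj₁ p ℕ.+ proj₂ q ℕₚ.≟ proj₁ q ℕ.+ proj₂ p)))
    public using (solve; _:=_; _:+_; _:*_; _:-_; :-_)

-- Order and absolute value

module OrderedField {c ℓ₁ ℓ₂} (R : RealField c ℓ₁ ℓ₂) where
  open Reals R
  open RealField R hiding (Carrier; _≈_; _<_; _*_; 0#; zero)
  open IntegerSolver commutativeRing
  open Algebra.Properties.Ring ring using (-0#≈0#; -‿involutive)

  private
    variable
      x y z w : Carrier

  ≈-stable : ¬ ¬ (x ≈ y) → x ≈ y
  ≈-stable {x} {y} ¬¬x≈y = proj₁ (tight x y) λ x#y → ¬¬x≈y λ x≈y → proj₂ (tight x y) x≈y x#y

  -- Goals of the form ¬ P, in particular x ≤ y, may be proved by trichotomy.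
  trichotomous : ∀ x y → ¬ ¬ (x < y ⊎ x ≈ y ⊎ y < x)
  trichotomous x y k = k (inj₂ (inj₁ (proj₁ (tight x y) λ x#y →
    case Equivalence.to #⇔<⊎> x#y of λ where
      (inj₁ x<y) → k (inj₁ x<y)
      (inj₂ y<x) → k (inj₂ (inj₂ y<x)))))

  <⇒≤ : x < y → x ≤ y
  <⇒≤ x<y y<x = <-asym x<y y<x

  ≈⇒≤ : x ≈ y → x ≤ y
  ≈⇒≤ x≈y y<x = <-irrefl (sym x≈y) y<x

  ≤-<-trans : x ≤ y → y < z → x < z
  ≤-<-trans {x} {y} {z} x≤y y<z
    with #-cotrans (Equivalence.from #⇔<⊎> (inj₁ y<z)) x
  ... | inj₁ y#x = case Equivalence.to #⇔<⊎> y#x of λ where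
      (inj₁ y<x) → contradiction y<x x≤y
      (inj₂ x<y) → <-trans x<y y<z
  ... | inj₂ x#z = case Equivalence.to #⇔<⊎> x#z of λ where
      (inj₁ x<z) → x<z
      (inj₂ z<x) → contradiction (<-trans y<z z<x) x≤y

  <-≤-trans : x < y → y ≤ z → x < z
  <-≤-trans {x} {y} {z} x<y y≤z
    with #-cotrans (Equivalence.from #⇔<⊎> (inj₁ x<y)) z
  ... | inj₁ x#z = case Equivalence.to #⇔<⊎> x#z of λ where
      (inj₁ x<z) → x<z
      (inj₂ z<x) → contradiction (<-trans z<x x<y) y≤z
  ... | inj₂ z#y = case Equivalence.to #⇔<⊎> z#y of λ where
      (inj₁ z<y) → contradiction z<y y≤z
      (inj₂ y<z) → <-trans x<y y<z

  ≤-trans : x ≤ y → y ≤ z → x ≤ z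
  ≤-trans x≤y y≤z z<x = y≤z (<-≤-trans z<x x≤y)

  ≤-antisym : x ≤ y → y ≤ x → x ≈ y
  ≤-antisym {x} {y} x≤y y≤x = proj₁ (tight x y) λ x#y →
    case Equivalence.to #⇔<⊎> x#y of λ where
      (inj₁ x<y) → y≤x x<y
      (inj₂ y<x) → x≤y y<x

  ≤-isPreorder : IsPreorder _≈_ _≤_
  ≤-isPreorder = record { isEquivalence = isEquivalence ; reflexive = ≈⇒≤ ; trans = ≤-trans }

  module ≤-Reasoning = Relation.Binary.Reasoning.Base.Triple
    ≤-isPreorder <-asym <-trans <-resp-≈ <⇒≤ <-≤-trans ≤-<-trans

  open ≤-Reasoning

  ≤-total : ∀ x y → ¬ ¬ (x ≤ y ⊎ y ≤ x)
  ≤-total x y k = k (inj₁ λ y<x → k (inj₂ (<⇒≤ y<x)))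

  +-monoˡ-< : ∀ z → x < y → x + z < y + z
  +-monoˡ-< z x<y = <-respˡ-≈ (+-comm z _) (<-respʳ-≈ (+-comm z _) (+-monoʳ-< z x<y))

  x<y⇒0<y-x : x < y → 0# < y - x
  x<y⇒0<y-x {x} {y} x<y = <-respˡ-≈ (-‿inverseʳ x) (+-monoˡ-< (- x) x<y)

  0<y-x⇒x<y : 0# < y - x → x < y
  0<y-x⇒x<y {y} {x} 0<y-x = <-respˡ-≈ (+-identityˡ x)
    (<-respʳ-≈ (solve 2 (λ x y → (y :- x) :+ x := y) refl x y) (+-monoˡ-< x 0<y-x))

  x≤y⇒0≤y-x : x ≤ y → 0# ≤ y - x
  x≤y⇒0≤y-x {x} {y} x≤y y-x<0 = x≤y (0<y-x⇒x<y
    (<-respʳ-≈ (solve 2 (λ x y → :- (y :- x) := x :- y) refl x y) (x<0⇒0<-x y-x<0)))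

  0≤y-x⇒x≤y : 0# ≤ y - x → x ≤ y
  0≤y-x⇒x≤y {y} {x} 0≤y-x y<x = 0≤y-x
    (<-respʳ-≈ (-‿inverseʳ x) (+-monoˡ-< (- x) y<x))

  +-monoʳ-≤ : ∀ z → x ≤ y → z + x ≤ z + y
  +-monoʳ-≤ {x} {y} z x≤y = 0≤y-x⇒x≤y (begin
    0#                 ≤⟨ x≤y⇒0≤y-x x≤y ⟩
    y - x              ≈⟨ solve 3 (λ x y z → y :- x := (z :+ y) :- (z :+ x)) refl x y z ⟩
    (z + y) - (z + x)  ∎)

  +-mono-≤ : x ≤ y → z ≤ w → x + z ≤ y + w
  +-mono-≤ {x} {y} {z} {w} x≤y z≤w = begin
    x + z  ≤⟨ +-monoʳ-≤ x z≤w ⟩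
    x + w  ≈⟨ +-comm x w ⟩
    w + x  ≤⟨ +-monoʳ-≤ w x≤y ⟩
    w + y  ≈⟨ +-comm w y ⟩
    y + w  ∎

  +-nonneg : 0# ≤ x → 0# ≤ y → 0# ≤ x + y
  +-nonneg 0≤x 0≤y = ≤-trans (≈⇒≤ (sym (+-identityʳ 0#))) (+-mono-≤ 0≤x 0≤y)

  *-nonneg : 0# ≤ x → 0# ≤ y → 0# ≤ x * y
  *-nonneg {x} {y} 0≤x 0≤y xy<0 = trichotomous x 0# λ where
    (inj₁ x<0)        → 0≤x x<0
    (inj₂ (inj₁ x≈0)) → <-irrefl (trans (*-congʳ x≈0) (zeroˡ y)) xy<0
    (inj₂ (inj₂ 0<x)) → trichotomous y 0# λ where
      (inj₁ y<0)        → 0≤y y<0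
      (inj₂ (inj₁ y≈0)) → <-irrefl (trans (*-congˡ y≈0) (zeroʳ x)) xy<0
      (inj₂ (inj₂ 0<y)) → <-asym xy<0 (*-pos 0<x 0<y)

  *-monoˡ-≤ : 0# ≤ z → x ≤ y → z * x ≤ z * y
  *-monoˡ-≤ {z} {x} {y} 0≤z x≤y = 0≤y-x⇒x≤y (begin
    0#             ≤⟨ *-nonneg 0≤z (x≤y⇒0≤y-x x≤y) ⟩
    z * (y - x)    ≈⟨ solve 3 (λ x y z → z :* (y :- x) := z :* y :- z :* x) refl x y z ⟩
    z * y - z * x  ∎)

  *-monoʳ-≤ : 0# ≤ z → x ≤ y → x * z ≤ y * z
  *-monoʳ-≤ {z} {x} {y} 0≤z x≤y = begin
    x * z  ≈⟨ *-comm x z ⟩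
    z * x  ≤⟨ *-monoˡ-≤ 0≤z x≤y ⟩
    z * y  ≈⟨ *-comm z y ⟩
    y * z  ∎

  *-monoˡ-< : 0# < z → x < y → z * x < z * y
  *-monoˡ-< {z} {x} {y} 0<z x<y = 0<y-x⇒x<y (<-respʳ-≈
    (solve 3 (λ x y z → z :* (y :- x) := z :* y :- z :* x) refl x y z)
    (*-pos 0<z (x<y⇒0<y-x x<y)))

  -‿antimono-≤ : x ≤ y → - y ≤ - x
  -‿antimono-≤ {x} {y} x≤y = 0≤y-x⇒x≤y (≤-trans (x≤y⇒0≤y-x x≤y)
    (≈⇒≤ (solve 2 (λ x y → y :- x := :- x :- :- y) refl x y)))

  ≤0⇒0≤- : x ≤ 0# → 0# ≤ - x
  ≤0⇒0≤- x≤0 = ≤-trans (≈⇒≤ (sym -0#≈0#)) (-‿antimono-≤ x≤0)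

  0≤⇒-≤0 : 0# ≤ x → - x ≤ 0#
  0≤⇒-≤0 0≤x = ≤-trans (-‿antimono-≤ 0≤x) (≈⇒≤ -0#≈0#)

  square-nonneg : ∀ x → 0# ≤ x * x
  square-nonneg x x²<0 = ≤-total 0# x λ where
    (inj₁ 0≤x) → *-nonneg 0≤x 0≤x x²<0
    (inj₂ x≤0) → *-nonneg (≤0⇒0≤- x≤0) (≤0⇒0≤- x≤0)
      (<-respˡ-≈ (solve 1 (λ x → x :* x := :- x :* :- x) refl x) x²<0)

  square≈0⇒≈0 : x * x ≈ 0# → x ≈ 0#
  square≈0⇒≈0 {x} x²≈0 = ≈-stable λ x≉0 → trichotomous x 0# λ where
    (inj₁ x<0)        → <-irrefl (sym (trans (solve 1 (λ x → :- x :* :- x := x :* x) refl x) x²≈0))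
                                 (*-pos (x<0⇒0<-x x<0) (x<0⇒0<-x x<0))
    (inj₂ (inj₁ x≈0)) → x≉0 x≈0
    (inj₂ (inj₂ 0<x)) → <-irrefl (sym x²≈0) (*-pos 0<x 0<x)

  *-cancelˡ-≈0 : 0# < x → x * y ≈ 0# → y ≈ 0#
  *-cancelˡ-≈0 {x} {y} 0<x xy≈0 = begin-equality
    y                       ≈⟨ *-identityˡ y ⟨
    1# * y                  ≈⟨ *-congʳ (recip-inverse 0<x) ⟨
    x * recip 0<x * y       ≈⟨ solve 3 (λ x r y → x :* r :* y := r :* (x :* y)) refl x (recip 0<x) y ⟩
    recip 0<x * (x * y)     ≈⟨ *-congˡ xy≈0 ⟩
    recip 0<x * 0#          ≈⟨ zeroʳ _ ⟩
    0#                      ∎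

  nonneg-sum≈0 : 0# ≤ x → 0# ≤ y → x + y ≈ 0# → x ≈ 0# × y ≈ 0#
  nonneg-sum≈0 {x} {y} 0≤x 0≤y x+y≈0 =
    ≤-antisym (≤-trans (x≤x+ 0≤y) (≈⇒≤ x+y≈0)) 0≤x ,
    ≤-antisym (≤-trans (x≤x+ 0≤x) (≈⇒≤ (trans (+-comm y x) x+y≈0))) 0≤y
    where
    x≤x+ : ∀ {a b} → 0# ≤ b → a ≤ a + b
    x≤x+ {a} 0≤b = ≤-trans (≈⇒≤ (sym (+-identityʳ a))) (+-monoʳ-≤ a 0≤b)

  ∨-least : x ≤ z → y ≤ z → x ∨ y ≤ z
  ∨-least {x} {z} {y} = λ p q → proj₂ (proj₂ (∨-supremum x y)) z p q

  0≤x⇒∣x∣≈x : 0# ≤ x → ∣ x ∣ ≈ x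
  0≤x⇒∣x∣≈x {x} 0≤x = ≤-antisym
    (∨-least (≈⇒≤ refl) (≤-trans (0≤⇒-≤0 0≤x) 0≤x)) (proj₁ (∨-supremum x (- x)))

  x≤0⇒∣x∣≈-x : x ≤ 0# → ∣ x ∣ ≈ - x
  x≤0⇒∣x∣≈-x {x} x≤0 = ≤-antisym
    (∨-least (≤-trans x≤0 (≤0⇒0≤- x≤0)) (≈⇒≤ refl)) (proj₁ (proj₂ (∨-supremum x (- x))))

  x≤∣x∣ : ∀ x → x ≤ ∣ x ∣
  x≤∣x∣ x = proj₁ (∨-supremum x (- x))

  -x≤∣x∣ : ∀ x → - x ≤ ∣ x ∣
  -x≤∣x∣ x = proj₁ (proj₂ (∨-supremum x (- x)))

  ∣∣-cong : x ≈ y → ∣ x ∣ ≈ ∣ y ∣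
  ∣∣-cong {x} {y} x≈y = ≤-antisym (le x≈y) (le (sym x≈y))
    where
    le : ∀ {x y} → x ≈ y → ∣ x ∣ ≤ ∣ y ∣
    le x≈y = ∨-least (≤-trans (≈⇒≤ x≈y) (x≤∣x∣ _)) (≤-trans (≈⇒≤ (-‿cong x≈y)) (-x≤∣x∣ _))

  0≤∣x∣ : ∀ x → 0# ≤ ∣ x ∣
  0≤∣x∣ x ∣x∣<0 = ≤-total 0# x λ where
    (inj₁ 0≤x) → ≤-trans 0≤x (x≤∣x∣ x) ∣x∣<0
    (inj₂ x≤0) → ≤-trans (≤0⇒0≤- x≤0) (-x≤∣x∣ x) ∣x∣<0

  ∣x+y∣≤∣x∣+∣y∣ : ∀ x y → ∣ x + y ∣ ≤ ∣ x ∣ + ∣ y ∣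
  ∣x+y∣≤∣x∣+∣y∣ x y = ∨-least (+-mono-≤ (x≤∣x∣ x) (x≤∣x∣ y))
    (≤-trans (≈⇒≤ (solve 2 (λ x y → :- (x :+ y) := :- x :+ :- y) refl x y))
             (+-mono-≤ (-x≤∣x∣ x) (-x≤∣x∣ y)))

  -- The signs of `x` and `y` are known only under a double negation, which the stability of `≈`
  -- removes.
  ∣x*y∣≈∣x∣*∣y∣ : ∀ x y → ∣ x * y ∣ ≈ ∣ x ∣ * ∣ y ∣
  ∣x*y∣≈∣x∣*∣y∣ x y = ≈-stable λ k → ≤-total 0# x λ p → ≤-total 0# y λ q → k (cases p q)
    where
    cases : 0# ≤ x ⊎ x ≤ 0# → 0# ≤ y ⊎ y ≤ 0# → ∣ x * y ∣ ≈ ∣ x ∣ * ∣ y ∣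
    cases (inj₁ 0≤x) (inj₁ 0≤y) = trans (0≤x⇒∣x∣≈x (*-nonneg 0≤x 0≤y))
      (*-cong (sym (0≤x⇒∣x∣≈x 0≤x)) (sym (0≤x⇒∣x∣≈x 0≤y)))
    cases (inj₁ 0≤x) (inj₂ y≤0) = begin-equality
      ∣ x * y ∣      ≈⟨ x≤0⇒∣x∣≈-x (≤-trans (*-monoˡ-≤ 0≤x y≤0) (≈⇒≤ (zeroʳ x))) ⟩
      - (x * y)      ≈⟨ solve 2 (λ x y → :- (x :* y) := x :* :- y) refl x y ⟩
      x * - y        ≈⟨ *-cong (0≤x⇒∣x∣≈x 0≤x) (x≤0⇒∣x∣≈-x y≤0) ⟨
      ∣ x ∣ * ∣ y ∣  ∎
    cases (inj₂ x≤0) (inj₁ 0≤y) = begin-equality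
      ∣ x * y ∣      ≈⟨ x≤0⇒∣x∣≈-x (≤-trans (*-monoʳ-≤ 0≤y x≤0) (≈⇒≤ (zeroˡ y))) ⟩
      - (x * y)      ≈⟨ solve 2 (λ x y → :- (x :* y) := :- x :* y) refl x y ⟩
      - x * y        ≈⟨ *-cong (x≤0⇒∣x∣≈-x x≤0) (0≤x⇒∣x∣≈x 0≤y) ⟨
      ∣ x ∣ * ∣ y ∣  ∎
    cases (inj₂ x≤0) (inj₂ y≤0) = begin-equality
      ∣ x * y ∣      ≈⟨ ∣∣-cong (solve 2 (λ x y → x :* y := :- x :* :- y) refl x y) ⟩
      ∣ - x * - y ∣  ≈⟨ 0≤x⇒∣x∣≈x (*-nonneg (≤0⇒0≤- x≤0) (≤0⇒0≤- y≤0)) ⟩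
      - x * - y      ≈⟨ *-cong (x≤0⇒∣x∣≈-x x≤0) (x≤0⇒∣x∣≈-x y≤0) ⟨
      ∣ x ∣ * ∣ y ∣  ∎

  ∣0∣≈0 : ∣ 0# ∣ ≈ 0#
  ∣0∣≈0 = 0≤x⇒∣x∣≈x (≈⇒≤ refl)

  ∣x∣≤0⇒x≈0 : ∣ x ∣ ≤ 0# → x ≈ 0#
  ∣x∣≤0⇒x≈0 {x} ∣x∣≤0 = ≤-antisym (≤-trans (x≤∣x∣ x) ∣x∣≤0)
    (≤-trans (x≤y⇒0≤y-x (≤-trans (-x≤∣x∣ x) ∣x∣≤0)) (≈⇒≤ (trans (+-identityˡ _) (-‿involutive x))))

-- Particle configurations

private
  variable
    k n : ℕ

module Occupation where
  open ≡ using (cong; trans; sym; refl)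

  inc dec : Vec ℕ n → Fin n → Vec ℕ n
  inc η j = updateAt η j suc
  dec η j = updateAt η j pred

  -- The hypothesis excludes the one value at which `pred` truncates; the opposite composite
  -- `dec-inc` has no such exception.
  inc-dec : (η : Vec ℕ n) (j : Fin n) → ∀ {a} → lookup η j ≡ suc a → inc (dec η j) j ≡ η
  inc-dec η j eq = trans (Vecₚ.updateAt-updateAt j η) (Vecₚ.updateAt-id-local j η (suc-pred eq))
    where
    suc-pred : ∀ {a b : ℕ} → a ≡ suc b → suc (pred a) ≡ a
    suc-pred refl = refl

  dec-inc : (ζ : Vec ℕ n) (j : Fin n) → dec (inc ζ j) j ≡ ζ
  dec-inc ζ j = trans (Vecₚ.updateAt-updateAt j ζ) (Vecₚ.updateAt-id j ζ)

  inc-injective : (j : Fin n) {ζ ξ : Vec ℕ n} → inc ζ j ≡ inc ξ j → ζ ≡ ξ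
  inc-injective j {ζ} {ξ} eq =
    trans (sym (dec-inc ζ j)) (trans (cong (λ η → dec η j) eq) (dec-inc ξ j))

  sum-inc : (ζ : Vec ℕ n) (j : Fin n) → Vec.sum (inc ζ j) ≡ suc (Vec.sum ζ)
  sum-inc (a ∷ ζ) zero    = refl
  sum-inc (a ∷ ζ) (suc j) = trans (cong (a ℕ.+_) (sum-inc ζ j)) (ℕₚ.+-suc a _)

  sum-replicate-0 : ∀ n → Vec.sum (Vec.replicate n 0) ≡ 0
  sum-replicate-0 zero    = refl
  sum-replicate-0 (suc n) = sum-replicate-0 n

  sum≡0⇒replicate : (η : Vec ℕ n) → Vec.sum η ≡ 0 → η ≡ Vec.replicate n 0
  sum≡0⇒replicate []         eq = refl
  sum≡0⇒replicate (zero ∷ η) eq = cong (0 ∷_) (sum≡0⇒replicate η eq)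

  ⊎ᵐ-incˡ : (u v : Multiset k) (r : Fin k) → inc u r ⊎ᵐ v ≡ inc (u ⊎ᵐ v) r
  ⊎ᵐ-incˡ (a ∷ u) (b ∷ v) zero    = refl
  ⊎ᵐ-incˡ (a ∷ u) (b ∷ v) (suc r) = cong (a ℕ.+ b ∷_) (⊎ᵐ-incˡ u v r)

  ⊎ᵐ-incʳ : (u v : Multiset k) (r : Fin k) → u ⊎ᵐ inc v r ≡ inc (u ⊎ᵐ v) r
  ⊎ᵐ-incʳ (a ∷ u) (b ∷ v) zero    = cong (_∷ (u ⊎ᵐ v)) (ℕₚ.+-suc a b)
  ⊎ᵐ-incʳ (a ∷ u) (b ∷ v) (suc r) = cong (a ℕ.+ b ∷_) (⊎ᵐ-incʳ u v r)

  -- A `jump c j r` unfolds to `add (remove c j r) (next j) r`, while `c` itself is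
  -- `add (remove c j r) j r` when the particle exists. Start and end of a jump are thus compared
  -- through `add` alone, the counterpart of `ζ + eⱼ` and `ζ + eⱼ₊₁`.
  add remove : Config n k → Fin n → Fin k → Config n k
  add    c j r = updateAt c j (λ u → inc u r)
  remove c j r = updateAt c j (λ u → dec u r)

  add-remove : (c : Config n k) (j : Fin n) (r : Fin k) →
               ∀ {a} → lookup (lookup c j) r ≡ suc a → add (remove c j r) j r ≡ c
  add-remove c j r eq = trans (Vecₚ.updateAt-updateAt j c)
    (Vecₚ.updateAt-id-local j c (inc-dec (lookup c j) r eq))

  ⋃ᵐ-add : (c : Config n k) (j : Fin n) (r : Fin k) → ⋃ᵐ (add c j r) ≡ inc (⋃ᵐ c) r
  ⋃ᵐ-add (u ∷ c) zero    r = ⊎ᵐ-incˡ u (⋃ᵐ c) r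
  ⋃ᵐ-add (u ∷ c) (suc j) r = trans (cong (u ⊎ᵐ_) (⋃ᵐ-add c j r)) (⊎ᵐ-incʳ u (⋃ᵐ c) r)

  -- The species with index r is counted by atLeast m i.
  reaches : Fin (suc k) → Fin k → Bool
  reaches zero    r       = true
  reaches (suc i) zero    = false
  reaches (suc i) (suc r) = reaches i r

  atLeast-inc : (u : Multiset k) (i : Fin (suc k)) (r : Fin k) →
    atLeast (inc u r) i ≡ (if reaches i r then suc (atLeast u i) else atLeast u i)
  atLeast-inc u       zero    r       = sum-inc u r
  atLeast-inc (a ∷ u) (suc i) zero    = refl
  atLeast-inc (a ∷ u) (suc i) (suc r) = atLeast-inc u i r

  atLeast-⊎ᵐ : (u v : Multiset k) (i : Fin (suc k)) →
               atLeast (u ⊎ᵐ v) i ≡ atLeast u i ℕ.+ atLeast v i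
  atLeast-⊎ᵐ []      []      zero    = refl
  atLeast-⊎ᵐ (a ∷ u) (b ∷ v) zero    = trans (cong (a ℕ.+ b ℕ.+_) (atLeast-⊎ᵐ u v zero))
    (interchange a b (Vec.sum u) (Vec.sum v))
    where
    open Algebra.Properties.CommutativeSemigroup ℕₚ.+-commutativeSemigroup using (interchange)
  atLeast-⊎ᵐ (a ∷ u) (b ∷ v) (suc i) = atLeast-⊎ᵐ u v i

  atLeast-∅ : ∀ k (i : Fin (suc k)) → atLeast (Vec.replicate k 0) i ≡ 0
  atLeast-∅ k       zero    = sum-replicate-0 k
  atLeast-∅ (suc k) (suc i) = atLeast-∅ k i

  lookup+atLeast : (u : Multiset k) (r : Fin k) →
                   lookup u r ℕ.+ atLeast u (suc r) ≡ atLeast u (inject₁ r)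
  lookup+atLeast (a ∷ u) zero    = refl
  lookup+atLeast (a ∷ u) (suc r) = lookup+atLeast u r

  lump : Fin (suc k) → Config n k → Vec ℕ n
  lump i = Vec.map (λ u → atLeast u i)

  lump-add-true : (i : Fin (suc k)) (c : Config n k) (j : Fin n) (r : Fin k) →
    reaches i r ≡ true → lump i (add c j r) ≡ inc (lump i c) j
  lump-add-true i c j r eq = Vecₚ.map-updateAt c j
    (trans (atLeast-inc (lookup c j) i r) (cong (if_then _ else _) eq))

  lump-add-false : (i : Fin (suc k)) (c : Config n k) (j : Fin n) (r : Fin k) →
    reaches i r ≡ false → lump i (add c j r) ≡ lump i c
  lump-add-false i c j r eq = trans
    -- The added particle is invisible at this threshold, so under `map` its insertion becomes an
    -- update by the identity.
    (Vecₚ.map-updateAt {h = λ a → a} c j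
      (trans (atLeast-inc (lookup c j) i r) (cong (if_then _ else _) eq)))
    (Vecₚ.updateAt-id j _)

  sum-lump : (i : Fin (suc k)) (c : Config n k) → Vec.sum (lump i c) ≡ atLeast (⋃ᵐ c) i
  sum-lump {k} i []      = sym (atLeast-∅ k i)
  sum-lump     i (u ∷ c) = trans (cong (atLeast u i ℕ.+_) (sum-lump i c)) (sym (atLeast-⊎ᵐ u (⋃ᵐ c) i))

-- Finite sums

module FiniteSums {c ℓ₁ ℓ₂} (R : RealField c ℓ₁ ℓ₂) where
  open Reals R
  open RealField R hiding (Carrier; _≈_; _<_; _*_; 0#; zero)
  open IntegerSolver commutativeRing
  open OrderedField R
  open Occupation
  open Algebra.Properties.Semiring.Sum semiring public
    using (∑-distrib-+; *-distribˡ-sum; *-distribʳ-sum; sum-init-last; sum-replicate-zero; sum-cong-≋)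
  open Algebra.Properties.Monoid.Sum (CommutativeRing.*-monoid commutativeRing) public
    using () renaming (sum-cong-≋ to product-cong; sum-init-last to product-init-last)
  open ≤-Reasoning

  if-yes : ∀ {p a} {P : Set p} {A : Set a} (P? : Dec P) {x y : A} → P → (if does P? then x else y) ≡ x
  if-yes P? p = ≡.cong (if_then _ else _) (dec-true P? p)

  if-no : ∀ {p a} {P : Set p} {A : Set a} (P? : Dec P) {x y : A} → ¬ P → (if does P? then x else y) ≡ y
  if-no P? ¬p = ≡.cong (if_then _ else _) (dec-false P? ¬p)

  sum-cong : ∀ {n} (f g : Vector Carrier n) → (∀ i → f i ≈ g i) → sum f ≈ sum g
  sum-cong f g = sum-cong-≋ {x = f} {y = g}

  private
    variable
      A B : Set

  -- Sums range over the list of an arbitrary enumeration, so that compositions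
  -- and configs, which reduce partially, are never unfolded.
  record Enumeration (P : A → Set) : Set where
    field
      list   : List A
      unique : Unique list
      ∈⇔     : ∀ {a} → a ∈ list ⇔ P a

    ∈⇒ : ∀ {a} → a ∈ list → P a
    ∈⇒ = Equivalence.to ∈⇔

    ⇒∈ : ∀ {a} → P a → a ∈ list
    ⇒∈ = Equivalence.from ∈⇔

  open Enumeration public using (list; unique; ∈⇒; ⇒∈)

  Σ-cong : ∀ (xs : List A) {f g : A → Carrier} →
           (∀ {a} → a ∈ xs → f a ≈ g a) → Σ[ xs ] f ≈ Σ[ xs ] g
  Σ-cong []       eq = refl
  Σ-cong (x ∷ xs) eq = +-cong (eq (here ≡.refl)) (Σ-cong xs (eq ∘ there))

  Σ-zero : ∀ (xs : List A) {f : A → Carrier} → (∀ {a} → a ∈ xs → f a ≈ 0#) → Σ[ xs ] f ≈ 0#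
  Σ-zero []       eq = refl
  Σ-zero (x ∷ xs) eq = trans (+-cong (eq (here ≡.refl)) (Σ-zero xs (eq ∘ there))) (+-identityʳ 0#)

  Σ-+ : ∀ (xs : List A) (f g : A → Carrier) → Σ[ xs ] (λ a → f a + g a) ≈ Σ[ xs ] f + Σ[ xs ] g
  Σ-+ []       f g = sym (+-identityʳ 0#)
  Σ-+ (x ∷ xs) f g = trans (+-congˡ (Σ-+ xs f g)) (interchange _ _ _ _)
    where
    open Algebra.Properties.CommutativeSemigroup
      (CommutativeRing.+-commutativeSemigroup commutativeRing) using (interchange)

  Σ-*ˡ : ∀ a (xs : List A) (f : A → Carrier) → a * Σ[ xs ] f ≈ Σ[ xs ] λ x → a * f x
  Σ-*ˡ a []       f = zeroʳ a
  Σ-*ˡ a (x ∷ xs) f = trans (distribˡ a _ _) (+-congˡ (Σ-*ˡ a xs f))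

  Σ-*ʳ : ∀ a (xs : List A) (f : A → Carrier) → Σ[ xs ] f * a ≈ Σ[ xs ] λ x → f x * a
  Σ-*ʳ a xs f = trans (*-comm _ a) (trans (Σ-*ˡ a xs f) (Σ-cong xs λ _ → *-comm a _))

  Σ-comm : ∀ (xs : List A) (ys : List B) (f : A → B → Carrier) →
           Σ[ xs ] (λ a → Σ[ ys ] (f a)) ≈ Σ[ ys ] λ b → Σ[ xs ] λ a → f a b
  Σ-comm []       ys f = sym (Σ-zero ys λ _ → refl)
  Σ-comm (x ∷ xs) ys f = trans (+-congˡ (Σ-comm xs ys f)) (sym (Σ-+ ys (f x) _))

  Σ-sum-comm : ∀ (xs : List A) {n} (f : A → Fin n → Carrier) →
               Σ[ xs ] (λ a → sum (f a)) ≈ sum λ j → Σ[ xs ] λ a → f a j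
  Σ-sum-comm []       {n} f = sym (sum-replicate-zero n)
  Σ-sum-comm (x ∷ xs) {n} f = trans (+-congˡ (Σ-sum-comm xs f)) (sym (∑-distrib-+ (f x) _))

  Σ-isolate : ∀ {xs : List A} {z} {f : A → Carrier} → Unique xs → z ∈ xs →
              (∀ {a} → a ∈ xs → z ≢ a → f a ≈ 0#) → Σ[ xs ] f ≈ f z
  Σ-isolate {xs = x ∷ xs} (x∉ ∷ u) (here ≡.refl) off =
    trans (+-congˡ (Σ-zero xs λ a∈ → off (there a∈) (ListAll.lookup x∉ a∈))) (+-identityʳ _)
  Σ-isolate {xs = x ∷ xs} (x∉ ∷ u) (there z∈) off =
    trans (+-cong (off (here ≡.refl) (ListAll.lookup x∉ z∈ ∘ ≡.sym)) (Σ-isolate u z∈ (off ∘ there)))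
          (+-identityˡ _)

  -- Double counting of the pairs with `φ b ≡ a`: each `b` has one image, each `a` has at most one
  -- preimage by injectivity, and an `a` outside the image has `f a ≈ 0#`. So `φ` only has to cover
  -- the support of `f`.
  Σ-reindex : DecidableEquality A → ∀ {xs : List A} {ys : List B} {φ : B → A} {f : A → Carrier} →
    Unique xs → Unique ys → (∀ {b b′} → φ b ≡ φ b′ → b ≡ b′) →
    (∀ {b} → b ∈ ys → φ b ∈ xs) →
    (∀ {a} → a ∈ xs → (∃[ b ] (b ∈ ys × φ b ≡ a)) ⊎ f a ≈ 0#) →
    Σ[ xs ] f ≈ Σ[ ys ] (f ∘ φ)
  Σ-reindex _≟_ {xs} {ys} {φ} {f} uxs uys φ-injective φ-into onto = begin-equality
    Σ[ xs ] f                                                               ≈⟨ Σ-cong xs split ⟩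
    Σ[ xs ] (λ a → Σ[ ys ] λ b → if does (φ b ≟ a) then f a else 0#)   ≈⟨ Σ-comm xs ys _ ⟩
    Σ[ ys ] (λ b → Σ[ xs ] λ a → if does (φ b ≟ a) then f a else 0#)   ≈⟨ Σ-cong ys collect ⟩
    Σ[ ys ] (f ∘ φ)                                                         ∎
    where
    split : ∀ {a} → a ∈ xs → f a ≈ Σ[ ys ] λ b → if does (φ b ≟ a) then f a else 0#
    split {a} a∈ with onto a∈
    ... | inj₁ (b , b∈ , ≡.refl) = sym (trans
          (Σ-isolate uys b∈ λ {b′} _ b≢b′ → reflexive (if-no (φ b′ ≟ a) (b≢b′ ∘ ≡.sym ∘ φ-injective)))
          (reflexive (if-yes (φ b ≟ a) ≡.refl)))
    ... | inj₂ fa≈0 = trans fa≈0 (sym (Σ-zero ys λ {b} _ → vanish b))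
      where
      vanish : ∀ b → (if does (φ b ≟ a) then f a else 0#) ≈ 0#
      vanish b with φ b ≟ a
      ... | yes _ = fa≈0
      ... | no  _ = refl

    collect : ∀ {b} → b ∈ ys → Σ[ xs ] (λ a → if does (φ b ≟ a) then f a else 0#) ≈ f (φ b)
    collect {b} b∈ = trans
      (Σ-isolate uxs (φ-into b∈) λ {a} _ φb≢a → reflexive (if-no (φ b ≟ a) φb≢a))
      (reflexive (if-yes (φ b ≟ φ b) ≡.refl))

  Σ-nonneg : ∀ (xs : List A) {f : A → Carrier} → (∀ a → 0# ≤ f a) → 0# ≤ Σ[ xs ] f
  Σ-nonneg []       f≥0 = ≈⇒≤ refl
  Σ-nonneg (x ∷ xs) f≥0 = +-nonneg (f≥0 x) (Σ-nonneg xs f≥0)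

  Σ-nonneg≈0 : ∀ {xs : List A} {f : A → Carrier} → (∀ a → 0# ≤ f a) → Σ[ xs ] f ≈ 0# →
               ∀ {a} → a ∈ xs → f a ≈ 0#
  Σ-nonneg≈0 {xs = x ∷ xs} f≥0 eq (here ≡.refl) = proj₁ (nonneg-sum≈0 (f≥0 x) (Σ-nonneg xs f≥0) eq)
  Σ-nonneg≈0 {xs = x ∷ xs} f≥0 eq (there a∈) =
    Σ-nonneg≈0 f≥0 (proj₂ (nonneg-sum≈0 (f≥0 x) (Σ-nonneg xs f≥0) eq)) a∈

  sum-nonneg : ∀ {n} {f : Vector Carrier n} → (∀ i → 0# ≤ f i) → 0# ≤ sum f
  sum-nonneg {zero}  f≥0 = ≈⇒≤ refl
  sum-nonneg {suc n} f≥0 = +-nonneg (f≥0 zero) (sum-nonneg (f≥0 ∘ suc))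

  sum-nonneg≈0 : ∀ {n} {f : Vector Carrier n} → (∀ i → 0# ≤ f i) → sum f ≈ 0# → ∀ i → f i ≈ 0#
  sum-nonneg≈0 f≥0 eq zero    = proj₁ (nonneg-sum≈0 (f≥0 zero) (sum-nonneg (f≥0 ∘ suc)) eq)
  sum-nonneg≈0 f≥0 eq (suc i) =
    sum-nonneg≈0 (f≥0 ∘ suc) (proj₂ (nonneg-sum≈0 (f≥0 zero) (sum-nonneg (f≥0 ∘ suc)) eq)) i

  -- Only the factor at `j` changes, and `q` is its growth. This is applied to powers, where `q` is
  -- `x j`, and to t-factorials, where `q` is the next t-integer.
  product-inc : ∀ {n} (F : Fin n → ℕ → Carrier) (ζ : Vec ℕ n) (j : Fin n) {q} →
    F j (suc (lookup ζ j)) ≈ q * F j (lookup ζ j) →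
    product (λ i → F i (lookup (inc ζ j) i)) ≈ q * product λ i → F i (lookup ζ i)
  product-inc F (a ∷ ζ) zero    eq = trans (*-congʳ eq) (*-assoc _ _ _)
  product-inc F (a ∷ ζ) (suc j) {q} eq = trans (*-congˡ (product-inc (F ∘ suc) ζ j eq))
    (solve 3 (λ u q v → u :* (q :* v) := q :* (u :* v)) refl (F zero a) q
      (product λ i → F (suc i) (lookup ζ i)))

  -- This is the connectedness of the simplex: the units in `v` are transferred one by one to `a`,
  -- each transfer preserves `F`, and so every value agrees with the one at the corner. Only
  -- transfers within total `N` are assumed, so that the invariance may come from a single simplex.
  gather : ∀ {n} N (F : ℕ → Vec ℕ n → Carrier) →
    (∀ a v i → a ℕ.+ suc (Vec.sum v) ≡ N → F a (inc v i) ≈ F (suc a) v) →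
    ∀ a v → a ℕ.+ Vec.sum v ≡ N → F a v ≈ F N (Vec.replicate n 0)
  gather N F move a []      eq =
    reflexive (≡.cong (λ b → F b []) (≡.trans (≡.sym (ℕₚ.+-identityʳ a)) eq))
  gather N F move a (zero ∷ v) eq =
    gather N (λ a v → F a (0 ∷ v)) (λ a v i → move a (0 ∷ v) (suc i)) a v eq
  gather N F move a (suc b ∷ v) eq = trans (move a (b ∷ v) zero eq)
    (gather N F move (suc a) (b ∷ v) (≡.trans (≡.sym (ℕₚ.+-suc a _)) eq))

-- Derivatives and logarithms

module Calculus {c ℓ₁ ℓ₂} (R : RealField c ℓ₁ ℓ₂) where
  open Reals R
  open RealField R hiding (Carrier; _≈_; _<_; _*_; 0#; zero)
  open IntegerSolver commutativeRing
  open Algebra.Properties.Ring ring using (x≈y⇒x∙y⁻¹≈ε; x∙y⁻¹≈ε⇒x≈y; -0#≈0#; -1*x≈-x)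
  open OrderedField R
  open ≤-Reasoning

  Fun : Set _
  Fun = ∀ y → 0# < y → Carrier

  -- e y = o(y - x)
  Negligible : Carrier → Fun → Set _
  Negligible x e = ∀ ε → 0# < ε → ∃[ δ ] (0# < δ × (∀ y y>0 → ∣ y - x ∣ < δ →
    ∣ e y y>0 ∣ ≤ ε * ∣ y - x ∣))

  -- The witness ab/(a + b) avoids proving that _∨_ preserves strict inequalities.
  minimum : ∀ {a b} → 0# < a → 0# < b →
            ∃[ m ] (0# < m × (∀ {z} → z < m → z < a) × (∀ {z} → z < m → z < b))
  minimum {a} {b} 0<a 0<b =
    a * b * r , *-pos (*-pos 0<a 0<b) 0<r ,
    (λ z<m → <-trans z<m (0<y-x⇒x<y (<-respʳ-≈ a-m (*-pos (*-pos 0<a 0<a) 0<r)))) ,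
    (λ z<m → <-trans z<m (0<y-x⇒x<y (<-respʳ-≈ b-m (*-pos (*-pos 0<b 0<b) 0<r))))
    where
    r = recip (+-pos 0<a 0<b)
    0<r = recip-pos (+-pos 0<a 0<b)

    a-m : a * a * r ≈ a - a * b * r
    a-m = begin-equality
      a * a * r                      ≈⟨ solve 3 (λ a b r → a :* a :* r := a :* ((a :+ b) :* r) :- a :* b :* r) refl a b r ⟩
      a * ((a + b) * r) - a * b * r  ≈⟨ +-congʳ (trans (*-congˡ (recip-inverse (+-pos 0<a 0<b))) (*-identityʳ a)) ⟩
      a - a * b * r                  ∎

    b-m : b * b * r ≈ b - a * b * r
    b-m = begin-equality
      b * b * r                      ≈⟨ solve 3 (λ a b r → b :* b :* r := b :* ((a :+ b) :* r) :- a :* b :* r) refl a b r ⟩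
      b * ((a + b) * r) - a * b * r  ≈⟨ +-congʳ (trans (*-congˡ (recip-inverse (+-pos 0<a 0<b))) (*-identityʳ b)) ⟩
      b - a * b * r                  ∎

  rescale : ∀ {K} → 0# < K → ∀ ε → 0# < ε → ∃[ ε′ ] (0# < ε′ × K * ε′ ≈ ε)
  rescale {K} 0<K ε 0<ε = recip 0<K * ε , *-pos (recip-pos 0<K) 0<ε ,
    trans (sym (*-assoc _ _ _)) (trans (*-congʳ (recip-inverse 0<K)) (*-identityˡ ε))

  -- Bounds are rescaled by division, which requires a positive constant; whether `∣ x ∣` vanishes
  -- cannot be decided, so `∣ x ∣ + 1#` takes its place.
  ∣x∣<∣x∣+1 : ∀ x → ∣ x ∣ < ∣ x ∣ + 1#
  ∣x∣<∣x∣+1 x = <-respˡ-≈ (+-identityʳ ∣ x ∣) (+-monoʳ-< ∣ x ∣ 0<1)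

  0<∣x∣+1 : ∀ x → 0# < ∣ x ∣ + 1#
  0<∣x∣+1 x = ≤-<-trans (0≤∣x∣ x) (∣x∣<∣x∣+1 x)

  module _ {x : Carrier} where

    negligible-cong : ∀ {e f} → (∀ y y>0 → e y y>0 ≈ f y y>0) → Negligible x e → Negligible x f
    negligible-cong e≈f E ε 0<ε with δ , 0<δ , bound ← E ε 0<ε =
      δ , 0<δ , λ y y>0 h → ≤-trans (≈⇒≤ (sym (∣∣-cong (e≈f y y>0)))) (bound y y>0 h)

    negligible-0 : Negligible x (λ _ _ → 0#)
    negligible-0 ε 0<ε = 1# , 0<1 , λ y y>0 _ →
      ≤-trans (≈⇒≤ ∣0∣≈0) (*-nonneg (<⇒≤ 0<ε) (0≤∣x∣ _))

    negligible-+ : ∀ {e f} → Negligible x e → Negligible x f →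
                   Negligible x (λ y y>0 → e y y>0 + f y y>0)
    negligible-+ {e} {f} E F ε 0<ε =
      let (ε′ , 0<ε′ , 2ε′≈ε) = rescale (+-pos 0<1 0<1) ε 0<ε
          (δ₁ , 0<δ₁ , bound₁) = E ε′ 0<ε′
          (δ₂ , 0<δ₂ , bound₂) = F ε′ 0<ε′
          (δ , 0<δ , <δ₁ , <δ₂) = minimum 0<δ₁ 0<δ₂
      in δ , 0<δ , λ y y>0 h → begin
        ∣ e y y>0 + f y y>0 ∣                ≤⟨ ∣x+y∣≤∣x∣+∣y∣ _ _ ⟩
        ∣ e y y>0 ∣ + ∣ f y y>0 ∣            ≤⟨ +-mono-≤ (bound₁ y y>0 (<δ₁ h)) (bound₂ y y>0 (<δ₂ h)) ⟩
        ε′ * ∣ y - x ∣ + ε′ * ∣ y - x ∣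
          -- The solver sees `1#` as a variable, so both coefficients are written out before they
          -- are collected.
          ≈⟨ +-cong (*-congʳ (*-identityˡ ε′)) (*-congʳ (*-identityˡ ε′)) ⟨
        1# * ε′ * ∣ y - x ∣ + 1# * ε′ * ∣ y - x ∣
          ≈⟨ solve 3 (λ o ε h → o :* ε :* h :+ o :* ε :* h := (o :+ o) :* ε :* h) refl 1# ε′ ∣ y - x ∣ ⟩
        (1# + 1#) * ε′ * ∣ y - x ∣           ≈⟨ *-congʳ 2ε′≈ε ⟩
        ε * ∣ y - x ∣                        ∎

    negligible-* : ∀ {e} (b : Fun) {K δ₀} → 0# < K → 0# < δ₀ →
      (∀ y y>0 → ∣ y - x ∣ < δ₀ → ∣ b y y>0 ∣ ≤ K) → Negligible x e →
      Negligible x (λ y y>0 → b y y>0 * e y y>0)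
    negligible-* {e} b {K} 0<K 0<δ₀ b≤K E ε 0<ε =
      let (ε′ , 0<ε′ , Kε′≈ε) = rescale 0<K ε 0<ε
          (δ₁ , 0<δ₁ , bound) = E ε′ 0<ε′
          (δ , 0<δ , <δ₀ , <δ₁) = minimum 0<δ₀ 0<δ₁
      in δ , 0<δ , λ y y>0 h → begin
        ∣ b y y>0 * e y y>0 ∣        ≈⟨ ∣x*y∣≈∣x∣*∣y∣ _ _ ⟩
        ∣ b y y>0 ∣ * ∣ e y y>0 ∣    ≤⟨ *-monoʳ-≤ (0≤∣x∣ _) (b≤K y y>0 (<δ₀ h)) ⟩
        K * ∣ e y y>0 ∣              ≤⟨ *-monoˡ-≤ (<⇒≤ 0<K) (bound y y>0 (<δ₁ h)) ⟩
        K * (ε′ * ∣ y - x ∣)         ≈⟨ *-assoc _ _ _ ⟨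
        K * ε′ * ∣ y - x ∣           ≈⟨ *-congʳ Kε′≈ε ⟩
        ε * ∣ y - x ∣                ∎

    negligible-*ˡ : ∀ {e} a → Negligible x e → Negligible x (λ y y>0 → a * e y y>0)
    negligible-*ˡ a = negligible-* (λ _ _ → a) (0<∣x∣+1 a) 0<1 (λ _ _ _ → <⇒≤ (∣x∣<∣x∣+1 a))

    negligible-quadratic : Negligible x (λ y _ → (y - x) * (y - x))
    negligible-quadratic ε 0<ε = ε , 0<ε , λ y y>0 h → begin
      ∣ (y - x) * (y - x) ∣    ≈⟨ ∣x*y∣≈∣x∣*∣y∣ _ _ ⟩
      ∣ y - x ∣ * ∣ y - x ∣    ≤⟨ *-monoʳ-≤ (0≤∣x∣ _) (<⇒≤ h) ⟩
      ε * ∣ y - x ∣            ∎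

  private
    -- `HasDerivativeAt` unfolds to `Negligible` of the error of the linear approximation. A rule of
    -- differentiation is therefore an identity between errors, as below, followed by a closure
    -- property of negligible functions.
    error-+ : ∀ a b d u v e h → a - b - d * h + (u - v - e * h) ≈ (a + u) - (b + v) - (d + e) * h
    error-+ = solve 7 (λ a b d u v e h → a :- b :- d :* h :+ (u :- v :- e :* h) := (a :+ u) :- (b :+ v) :- (d :+ e) :* h) refl

    error-*ˡ : ∀ a u v d h → a * (u - v - d * h) ≈ a * u - a * v - a * d * h
    error-*ˡ = solve 5 (λ a u v d h → a :* (u :- v :- d :* h) := a :* u :- a :* v :- a :* d :* h) refl

    error-id* : ∀ y x u v d → y * (u - v - d * (y - x)) + d * ((y - x) * (y - x)) ≈ y * u - x * v - (v + x * d) * (y - x)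
    error-id* = solve 5 (λ y x u v d → y :* (u :- v :- d :* (y :- x)) :+ d :* ((y :- x) :* (y :- x))
      := y :* u :- x :* v :- (v :+ x :* d) :* (y :- x)) refl

    error-∘ : ∀ p q d u v e h → p - q - d * (u - v) + d * (u - v - e * h) ≈ p - q - d * e * h
    error-∘ = solve 7 (λ p q d u v e h → p :- q :- d :* (u :- v) :+ d :* (u :- v :- e :* h) := p :- q :- d :* e :* h) refl

  module _ {x : Carrier} {x>0 : 0# < x} where

    derivative-cong : ∀ {f g D E} → (∀ y y>0 → f y y>0 ≈ g y y>0) → D ≈ E →
                      HasDerivativeAt f x x>0 D → HasDerivativeAt g x x>0 E
    derivative-cong f≈g D≈E = negligible-cong λ y y>0 →
      +-cong (+-cong (f≈g y y>0) (-‿cong (f≈g x x>0))) (-‿cong (*-congʳ D≈E))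

    derivative-const : ∀ a → HasDerivativeAt (λ _ _ → a) x x>0 0#
    derivative-const a = negligible-cong
      (λ y y>0 → sym (trans (+-congʳ (-‿inverseʳ a)) (trans (+-identityˡ _) (trans (-‿cong (zeroˡ _)) -0#≈0#))))
      negligible-0

    derivative-+ : ∀ {f g D E} → HasDerivativeAt f x x>0 D → HasDerivativeAt g x x>0 E →
                   HasDerivativeAt (λ y y>0 → f y y>0 + g y y>0) x x>0 (D + E)
    derivative-+ {f} {g} {D} {E} F G = negligible-cong
      (λ y y>0 → error-+ (f y y>0) (f x x>0) D (g y y>0) (g x x>0) E (y - x))
      (negligible-+ F G)

    derivative-*ˡ : ∀ {f D} a → HasDerivativeAt f x x>0 D →
                    HasDerivativeAt (λ y y>0 → a * f y y>0) x x>0 (a * D)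
    derivative-*ˡ {f} {D} a F = negligible-cong
      (λ y y>0 → error-*ˡ  a (f y y>0) (f x x>0) D (y - x))
      (negligible-*ˡ a F)

    derivative-sub : ∀ {f g D E} → HasDerivativeAt f x x>0 D → HasDerivativeAt g x x>0 E →
                     HasDerivativeAt (λ y y>0 → f y y>0 - g y y>0) x x>0 (D - E)
    derivative-sub {f} {g} {D} {E} F G = derivative-cong
      {f = λ y y>0 → f y y>0 + - 1# * g y y>0}
      (λ y y>0 → +-congˡ (-1*x≈-x _)) (+-congˡ (-1*x≈-x _))
      (derivative-+ F (derivative-*ˡ (- 1#) G))

    derivative-Σ : ∀ {A : Set} (as : List A) {f : A → Fun} {D : A → Carrier} →
      (∀ a → HasDerivativeAt (f a) x x>0 (D a)) →
      HasDerivativeAt (λ y y>0 → Σ[ as ] λ a → f a y y>0) x x>0 (Σ[ as ] D)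
    derivative-Σ []       F = derivative-const 0#
    derivative-Σ (a ∷ as) F = derivative-+ (F a) (derivative-Σ as F)

    -- y * g y has derivative g x + x * g′ since its error term is
    -- y * (error of g) + g′ * (y - x)².
    derivative-id* : ∀ {g D} → HasDerivativeAt g x x>0 D →
                     HasDerivativeAt (λ y y>0 → y * g y y>0) x x>0 (g x x>0 + x * D)
    derivative-id* {g} {D} G = negligible-cong
      (λ y y>0 → error-id*  y x (g y y>0) (g x x>0) D)
      (negligible-+
        (negligible-* (λ y _ → y) (0<∣x∣+1 x) 0<1
          (λ y y>0 h → begin
            ∣ y ∣                ≈⟨ ∣∣-cong (solve 2 (λ x y → y := x :+ (y :- x)) refl x y) ⟩
            ∣ x + (y - x) ∣      ≤⟨ ∣x+y∣≤∣x∣+∣y∣ _ _ ⟩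
            ∣ x ∣ + ∣ y - x ∣    ≤⟨ +-monoʳ-≤ ∣ x ∣ (<⇒≤ h) ⟩
            ∣ x ∣ + 1#           ∎)
          G)
        (negligible-*ˡ D negligible-quadratic))

    -- Stated for x times the derivative so that the exponent stays n.
    derivative-^ : ∀ n → ∃[ D ] (HasDerivativeAt (λ y _ → y ^ n) x x>0 D × x * D ≈ n · (x ^ n))
    derivative-^ zero    = 0# , derivative-const 1# , zeroʳ x
    derivative-^ (suc n) with D , D-derivative , xD≈ ← derivative-^ n =
      x ^ n + x * D , derivative-id* D-derivative , (begin-equality
        x * (x ^ n + x * D)            ≈⟨ distribˡ _ _ _ ⟩
        x * x ^ n + x * (x * D)        ≈⟨ +-congˡ (*-congˡ xD≈) ⟩
        x * x ^ n + x * (n · (x ^ n))  ≈⟨ +-congˡ (×-comm-* n x (x ^ n)) ⟩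
        suc n · (x ^ suc n)            ∎)
      where open Algebra.Properties.Semiring.Mult semiring using (×-comm-*)

    -- The error of the composite is the error of `L` at `f y` plus `D` times the error of `f`. The
    -- former is small relative to `f y - f x`, which a local Lipschitz bound compares with `y - x`.
    derivative-∘ : ∀ {L : Fun} {f D E} (f>0 : ∀ y y>0 → 0# < f y y>0) →
      HasDerivativeAt L (f x x>0) (f>0 x x>0) D → HasDerivativeAt f x x>0 E →
      HasDerivativeAt (λ y y>0 → L (f y y>0) (f>0 y y>0)) x x>0 (D * E)
    derivative-∘ {L} {f} {D} {E} f>0 ∂L ∂f = negligible-cong
      (λ y y>0 → error-∘  (L (f y y>0) (f>0 y y>0)) (L (f x x>0) (f>0 x x>0)) D (f y y>0) (f x x>0) E (y - x))
      (negligible-+ outer (negligible-*ˡ D ∂f))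
      where
      outer : Negligible x (λ y y>0 →
        L (f y y>0) (f>0 y y>0) - L (f x x>0) (f>0 x x>0) - D * (f y y>0 - f x x>0))
      outer ε 0<ε =
        let (ε′ , 0<ε′ , Kε′≈ε) = rescale (0<∣x∣+1 E) ε 0<ε
            -- Tolerance `1#` yields the Lipschitz constant `∣ E ∣ + 1#`. Dividing `δ₂` by it gives
            -- `δ₂′`, which keeps `f y` where the estimate for `L` holds.
            (δ₁ , 0<δ₁ , bound₁) = ∂f 1# 0<1
            (δ₂ , 0<δ₂ , bound₂) = ∂L ε′ 0<ε′
            (δ₂′ , 0<δ₂′ , Kδ₂′≈δ₂) = rescale (0<∣x∣+1 E) δ₂ 0<δ₂
            (δ , 0<δ , <δ₁ , <δ₂′) = minimum 0<δ₁ 0<δ₂′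
        in δ , 0<δ , λ y y>0 h →
          let lipschitz : ∣ f y y>0 - f x x>0 ∣ ≤ (∣ E ∣ + 1#) * ∣ y - x ∣
              lipschitz = begin
                ∣ f y y>0 - f x x>0 ∣
                  ≈⟨ ∣∣-cong (solve 4 (λ u v e h → u :- v := e :* h :+ (u :- v :- e :* h))
                       refl (f y y>0) (f x x>0) E (y - x)) ⟩
                ∣ E * (y - x) + (f y y>0 - f x x>0 - E * (y - x)) ∣
                  ≤⟨ ∣x+y∣≤∣x∣+∣y∣ _ _ ⟩
                ∣ E * (y - x) ∣ + ∣ f y y>0 - f x x>0 - E * (y - x) ∣
                  ≤⟨ +-mono-≤ (≈⇒≤ (∣x*y∣≈∣x∣*∣y∣ _ _)) (bound₁ y y>0 (<δ₁ h)) ⟩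
                ∣ E ∣ * ∣ y - x ∣ + 1# * ∣ y - x ∣
                  ≈⟨ distribʳ _ _ _ ⟨
                (∣ E ∣ + 1#) * ∣ y - x ∣ ∎
          in begin
            ∣ L (f y y>0) (f>0 y y>0) - L (f x x>0) (f>0 x x>0) - D * (f y y>0 - f x x>0) ∣
              ≤⟨ bound₂ (f y y>0) (f>0 y y>0) (≤-<-trans lipschitz
                   (<-respʳ-≈ Kδ₂′≈δ₂ (*-monoˡ-< (0<∣x∣+1 E) (<δ₂′ h)))) ⟩
            ε′ * ∣ f y y>0 - f x x>0 ∣
              ≤⟨ *-monoˡ-≤ (<⇒≤ 0<ε′) lipschitz ⟩
            ε′ * ((∣ E ∣ + 1#) * ∣ y - x ∣)
              ≈⟨ solve 3 (λ ε K h → ε :* (K :* h) := K :* ε :* h) refl ε′ (∣ E ∣ + 1#) ∣ y - x ∣ ⟩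
            (∣ E ∣ + 1#) * ε′ * ∣ y - x ∣
              ≈⟨ *-congʳ Kε′≈ε ⟩
            ε * ∣ y - x ∣ ∎

    -- If `y ≈ x`, then `∣ y - x ∣` vanishes and lies below every `δ`, so the error is bounded by
    -- zero. This makes `log` respect `≈` and ignore the choice of positivity proof.
    derivative⇒cong : ∀ {f D} → HasDerivativeAt f x x>0 D →
                      ∀ {y} (y>0 : 0# < y) → y ≈ x → f y y>0 ≈ f x x>0
    derivative⇒cong {f} {D} F {y} y>0 y≈x with δ , 0<δ , bound ← F 1# 0<1 =
      x∙y⁻¹≈ε⇒x≈y _ _ (begin-equality
        f y y>0 - f x x>0                 ≈⟨ solve 2 (λ u w → u := (u :- w) :+ w) refl _ (D * (y - x)) ⟩
        f y y>0 - f x x>0 - D * (y - x) + D * (y - x)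
          ≈⟨ +-cong (∣x∣≤0⇒x≈0 (≤-trans (bound y y>0 (<-respˡ-≈ (sym ∣y-x∣≈0) 0<δ))
                                        (≈⇒≤ (trans (*-congˡ ∣y-x∣≈0) (zeroʳ 1#)))))
                    (*-congˡ y-x≈0) ⟩
        0# + D * 0#                       ≈⟨ trans (+-identityˡ _) (zeroʳ D) ⟩
        0#                                ∎)
      where
      y-x≈0 = x≈y⇒x∙y⁻¹≈ε y≈x
      ∣y-x∣≈0 = trans (∣∣-cong y-x≈0) ∣0∣≈0

  module Logarithm {log : Fun} (isLog : IsLog log) where
    open IsLog isLog

    log-cong : ∀ {x y} (x>0 : 0# < x) (y>0 : 0# < y) → x ≈ y → log x x>0 ≈ log y y>0
    log-cong {y = y} x>0 y>0 x≈y = derivative⇒cong {x>0 = y>0} {f = log} (log-derivative y y>0) x>0 x≈y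

    log-1 : log 1# 0<1 ≈ 0#
    log-1 = begin-equality
      log 1# 0<1                                         ≈⟨ solve 1 (λ l → l := l :+ l :- l) refl _ ⟩
      log 1# 0<1 + log 1# 0<1 - log 1# 0<1               ≈⟨ +-congʳ (log-* 1# 1# 0<1 0<1) ⟨
      log (1# * 1#) (*-pos 0<1 0<1) - log 1# 0<1         ≈⟨ +-congʳ (log-cong _ _ (*-identityˡ 1#)) ⟩
      log 1# 0<1 - log 1# 0<1                            ≈⟨ -‿inverseʳ _ ⟩
      0#                                                 ∎

    log-quotient : ∀ {x y} (x>0 : 0# < x) (y>0 : 0# < y) →
      log (x * recip y>0) (*-pos x>0 (recip-pos y>0)) ≈ log x x>0 - log y y>0
    log-quotient {x} {y} x>0 y>0 = begin-equality
      log (x * recip y>0) (*-pos x>0 (recip-pos y>0))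
        ≈⟨ log-* x (recip y>0) x>0 (recip-pos y>0) ⟩
      log x x>0 + log (recip y>0) (recip-pos y>0)
        ≈⟨ solve 3 (λ a b r → a :+ r := a :- b :+ (b :+ r)) refl _ (log y y>0) _ ⟩
      log x x>0 - log y y>0 + (log y y>0 + log (recip y>0) (recip-pos y>0))
        ≈⟨ +-congˡ (log-* y (recip y>0) y>0 (recip-pos y>0)) ⟨
      log x x>0 - log y y>0 + log (y * recip y>0) (*-pos y>0 (recip-pos y>0))
        ≈⟨ +-congˡ (trans (log-cong _ 0<1 (recip-inverse y>0)) log-1) ⟩
      log x x>0 - log y y>0 + 0#
        ≈⟨ +-identityʳ _ ⟩
      log x x>0 - log y y>0 ∎

-- The single species process

module Weights {c ℓ₁ ℓ₂} (R : RealField c ℓ₁ ℓ₂) where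
  open Reals R
  open RealField R hiding (Carrier; _≈_; _<_; _*_; 0#; zero)
  open IntegerSolver commutativeRing
  open Algebra.Properties.Ring ring using (x≈y⇒x∙y⁻¹≈ε; x∙y⁻¹≈ε⇒x≈y)
  open OrderedField R
  open Occupation
  open FiniteSums R
  open ≤-Reasoning

  recip-*-cancel : ∀ {a b q} (a>0 : 0# < a) (b>0 : 0# < b) → b ≈ q * a → recip b>0 * q ≈ recip a>0
  recip-*-cancel {a} {b} {q} a>0 b>0 b≈qa = begin-equality
    recip b>0 * q                        ≈⟨ *-identityʳ _ ⟨
    recip b>0 * q * 1#                   ≈⟨ *-congˡ (recip-inverse a>0) ⟨
    recip b>0 * q * (a * recip a>0)      ≈⟨ solve 4 (λ r q a s → r :* q :* (a :* s) := q :* a :* r :* s) refl (recip b>0) q a (recip a>0) ⟩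
    q * a * recip b>0 * recip a>0        ≈⟨ *-congʳ (*-congʳ b≈qa) ⟨
    b * recip b>0 * recip a>0            ≈⟨ *-congʳ (recip-inverse b>0) ⟩
    1# * recip a>0                       ≈⟨ *-identityˡ _ ⟩
    recip a>0                            ∎

  module _ {t : Carrier} (t>0 : 0# < t) where
    open TAnalogues t>0

    []ₜ-suc : ∀ a → [ suc a ]ₜ ≈ 1# + t * [ a ]ₜ
    []ₜ-suc a = +-congˡ (sym (*-distribˡ-sum t (λ i → t ^ toℕ {a} i)))

    []ₜ-+ : ∀ b a → [ b ℕ.+ a ]ₜ ≈ [ b ]ₜ + t ^ b * [ a ]ₜ
    []ₜ-+ zero    a = trans (sym (*-identityˡ _)) (sym (+-identityˡ _))
    []ₜ-+ (suc b) a = begin-equality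
      [ suc (b ℕ.+ a) ]ₜ                        ≈⟨ []ₜ-suc (b ℕ.+ a) ⟩
      1# + t * [ b ℕ.+ a ]ₜ                     ≈⟨ +-congˡ (*-congˡ ([]ₜ-+ b a)) ⟩
      1# + t * ([ b ]ₜ + t ^ b * [ a ]ₜ)        ≈⟨ solve 5 (λ o t u v w → o :+ t :* (u :+ v :* w) := (o :+ t :* u) :+ t :* v :* w)
                                                     refl 1# t [ b ]ₜ (t ^ b) [ a ]ₜ ⟩
      1# + t * [ b ]ₜ + t ^ suc b * [ a ]ₜ      ≈⟨ +-congʳ ([]ₜ-suc b) ⟨
      [ suc b ]ₜ + t ^ suc b * [ a ]ₜ           ∎

    -- The factors are listed in increasing order, so the new one is the last and has to be split
    -- off at the end of the product.
    []ₜ!-suc : ∀ a → [ suc a ]ₜ! ≈ [ suc a ]ₜ * [ a ]ₜ!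
    []ₜ!-suc a = begin-equality
      [ suc a ]ₜ!                                                   ≈⟨ product-init-last (λ i → [ suc (toℕ {suc a} i) ]ₜ) ⟩
      product (λ i → [ suc (toℕ (inject₁ {a} i)) ]ₜ) * [ suc (toℕ (fromℕ a)) ]ₜ
        ≈⟨ *-cong (product-cong {a} λ i → reflexive (≡.cong (λ b → [ suc b ]ₜ) (Finₚ.toℕ-inject₁ i)))
                  (reflexive (≡.cong (λ b → [ suc b ]ₜ) (Finₚ.toℕ-fromℕ a))) ⟩
      [ a ]ₜ! * [ suc a ]ₜ                                          ≈⟨ *-comm _ _ ⟩
      [ suc a ]ₜ * [ a ]ₜ!                                          ∎

    when : Bool → Carrier → Carrier
    when b a = if b then a else 0#

    -- The rate `t^d [c]ₜ` is the block of powers of `t` with exponents from `d` to `d + c - 1`. As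
    -- `d` counts the larger particles, the blocks of successive species abut, starting from
    -- exponent zero at the largest species, and together form one geometric sum.
    lumped-rate : ∀ {k} (u : Multiset k) (i : Fin (suc k)) →
      sum (λ r → when (reaches i r) (t ^ atLeast u (suc r) * [ lookup u r ]ₜ)) ≈ [ atLeast u i ]ₜ
    lumped-rate []      zero    = refl
    lumped-rate (a ∷ u) (suc i) = trans (+-identityˡ _) (lumped-rate u i)
    lumped-rate (a ∷ u) zero    = begin-equality
      t ^ Vec.sum u * [ a ]ₜ + sum (λ r → t ^ atLeast u (suc r) * [ lookup u r ]ₜ)
        ≈⟨ +-congˡ (lumped-rate u zero) ⟩
      t ^ Vec.sum u * [ a ]ₜ + [ Vec.sum u ]ₜ
        ≈⟨ +-comm _ _ ⟩
      [ Vec.sum u ]ₜ + t ^ Vec.sum u * [ a ]ₜ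
        ≈⟨ []ₜ-+ (Vec.sum u) a ⟨
      [ Vec.sum u ℕ.+ a ]ₜ
        ≈⟨ reflexive (≡.cong [_]ₜ (ℕₚ.+-comm (Vec.sum u) a)) ⟩
      [ a ℕ.+ Vec.sum u ]ₜ ∎

    next-inject₁ : ∀ {n} (j : Fin n) → next (inject₁ j) ≡ suc j
    next-inject₁ {n} j = Finₚ.toℕ-injective (≡.trans (Finₚ.toℕ-fromℕ< _)
      (≡.trans (DivMod.m<n⇒m%n≡m (ℕ.s≤s (≡.subst (ℕ._< n) (≡.sym (Finₚ.toℕ-inject₁ j)) (Finₚ.toℕ<n j))))
               (≡.cong suc (Finₚ.toℕ-inject₁ j))))

    next-fromℕ : ∀ n → next (fromℕ n) ≡ zero
    next-fromℕ n = Finₚ.toℕ-injective (≡.trans (Finₚ.toℕ-fromℕ< _)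
      (≡.trans (≡.cong (λ a → suc a DivMod.% suc n) (Finₚ.toℕ-fromℕ n)) (DivMod.n%n≡0 (suc n))))

    sum-next : ∀ {n} (f : Vector Carrier (suc n)) → sum (f ∘ next) ≈ sum f
    sum-next {n} f = begin-equality
      sum (f ∘ next)                                     ≈⟨ sum-init-last (f ∘ next) ⟩
      sum (f ∘ next ∘ inject₁) + f (next (fromℕ n))
        ≈⟨ +-cong (sum-cong (f ∘ next ∘ inject₁) (f ∘ suc) λ j → reflexive (≡.cong f (next-inject₁ j)))
                  (reflexive (≡.cong f (next-fromℕ n))) ⟩
      sum (f ∘ suc) + f zero                             ≈⟨ +-comm _ _ ⟩
      sum f                                              ∎

    -- 2 u (v - u) = (v² - u²) - (v - u)², and the differences v² - u² cancel
    -- around the ring.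
    cyclic-square : ∀ {n} (a : Vector Carrier (suc n)) →
      let d = λ j → a (next j) - a j
          s = sum λ j → a j * d j
      in sum (λ j → d j * d j) + (s + s) ≈ 0#
    cyclic-square a = begin-equality
      sum (λ j → d j * d j) + (sum (λ j → a j * d j) + sum (λ j → a j * d j))
        ≈⟨ +-congˡ (∑-distrib-+ (λ j → a j * d j) (λ j → a j * d j)) ⟨
      sum (λ j → d j * d j) + sum (λ j → a j * d j + a j * d j)
        ≈⟨ ∑-distrib-+ (λ j → d j * d j) (λ j → a j * d j + a j * d j) ⟨
      sum (λ j → d j * d j + (a j * d j + a j * d j))
        ≈⟨ solve 2 (λ s u → s := s :+ u :- u) refl _ (sum λ j → a j * a j) ⟩
      sum (λ j → d j * d j + (a j * d j + a j * d j)) + sum (λ j → a j * a j) - sum (λ j → a j * a j)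
        ≈⟨ +-congʳ (∑-distrib-+ (λ j → d j * d j + (a j * d j + a j * d j)) (λ j → a j * a j)) ⟨
      sum (λ j → d j * d j + (a j * d j + a j * d j) + a j * a j) - sum (λ j → a j * a j)
        ≈⟨ +-congʳ (sum-cong (λ j → d j * d j + (a j * d j + a j * d j) + a j * a j) (λ j → a (next j) * a (next j))
             λ j → square (a j) (a (next j))) ⟩
      sum (λ j → a (next j) * a (next j)) - sum (λ j → a j * a j)
        ≈⟨ x≈y⇒x∙y⁻¹≈ε (sum-next λ j → a j * a j) ⟩
      0# ∎
      where
      d = λ j → a (next j) - a j
      square : ∀ u v → (v - u) * (v - u) + (u * (v - u) + u * (v - u)) + u * u ≈ v * v
      square = solve 2 (λ u v → (v :- u) :* (v :- u) :+ (u :* (v :- u) :+ u :* (v :- u)) :+ u :* u := v :* v) refl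

    module SingleSpecies {n : ℕ} {x : Vector Carrier (suc n)} (x>0 : Positive x) where

      weight : Vec ℕ (suc n) → Carrier
      weight η = recip (product-!-pos η) * product λ i → x i ^ lookup η i

      weight-pos : ∀ η → 0# < weight η
      weight-pos η = *-pos (recip-pos (product-!-pos η))
        (product-pos _ λ i → ^-pos (x>0 i) (lookup η i))

      departureRate : Vec ℕ (suc n) → Fin (suc n) → Carrier
      departureRate η j = recip (x>0 j) * [ lookup η j ]ₜ

      -- The right side is independent of `j`; hence a single weight multiplies the whole cyclic sum
      -- in `energy`.
      weight-inc : ∀ ζ j → weight (inc ζ j) * departureRate (inc ζ j) j ≈ weight ζ
      weight-inc ζ j = begin-equality
        rᵢ * product (λ i → x i ^ lookup (inc ζ j) i) * (recip (x>0 j) * [ lookup (inc ζ j) j ]ₜ)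
          ≈⟨ *-cong (*-congˡ (product-inc (λ i a → x i ^ a) ζ j refl))
                    (*-congˡ (reflexive (≡.cong [_]ₜ (Vecₚ.lookup∘updateAt j ζ)))) ⟩
        rᵢ * (x j * X) * (recip (x>0 j) * q)
          ≈⟨ solve 5 (λ r x X s q → r :* (x :* X) :* (s :* q) := (x :* s) :* ((r :* q) :* X)) refl rᵢ (x j) X (recip (x>0 j)) q ⟩
        (x j * recip (x>0 j)) * ((rᵢ * q) * X)
          ≈⟨ *-cong (recip-inverse (x>0 j)) (*-congʳ (recip-*-cancel (product-!-pos ζ) (product-!-pos (inc ζ j))
               (product-inc (λ _ → [_]ₜ!) ζ j ([]ₜ!-suc (lookup ζ j))))) ⟩
        1# * weight ζ
          ≈⟨ *-identityˡ _ ⟩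
        weight ζ ∎
        where
        rᵢ = recip (product-!-pos (inc ζ j))
        X = product λ i → x i ^ lookup ζ i
        q = [ suc (lookup ζ j) ]ₜ

      Simplex : ℕ → Set
      Simplex M = Enumeration λ (η : Vec ℕ (suc n)) → Vec.sum η ≡ M

      hop : Vec ℕ (suc n) → Fin (suc n) → Vec ℕ (suc n)
      hop η j = inc (dec η j) (next j)

      generator : (Vec ℕ (suc n) → Carrier) → Vec ℕ (suc n) → Carrier
      generator G η = sum λ j → departureRate η j * (G (hop η j) - G η)

      -- The substitution is `η = ζ + eⱼ`. It misses the `η` with site `j` empty, whose departure
      -- rate vanishes because `[ 0 ]ₜ` is the empty sum.
      Σ-departures : ∀ {M M₁} (E : Simplex M) (E₁ : Simplex M₁) → M ≡ suc M₁ →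
        ∀ j (A : Vec ℕ (suc n) → Carrier) →
        Σ[ list E ] (λ η → weight η * departureRate η j * A η)
          ≈ Σ[ list E₁ ] λ ζ → weight ζ * A (inc ζ j)
      Σ-departures E E₁ M≡ j A = trans
        (Σ-reindex (Vecₚ.≡-dec ℕₚ._≟_) (unique E) (unique E₁) (inc-injective j)
          (λ {ζ} ζ∈ → ⇒∈ E
            (≡.trans (sum-inc ζ j) (≡.trans (≡.cong suc (∈⇒ E₁ ζ∈)) (≡.sym M≡))))
          onto)
        (Σ-cong (list E₁) λ {ζ} _ → *-congʳ (weight-inc ζ j))
        where
        onto : ∀ {η} → η ∈ list E →
          (∃[ ζ ] (ζ ∈ list E₁ × inc ζ j ≡ η)) ⊎ weight η * departureRate η j * A η ≈ 0#
        onto {η} η∈ with lookup η j in eq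
        ... | zero  = inj₂ (trans (*-congʳ (trans (*-congˡ (zeroʳ _)) (zeroʳ _))) (zeroˡ _))
        ... | suc a = inj₁ (dec η j , ⇒∈ E₁ (ℕₚ.suc-injective
              (≡.trans (≡.sym (sum-inc (dec η j) j))
                (≡.trans (≡.cong Vec.sum (inc-dec η j eq)) (≡.trans (∈⇒ E η∈) M≡))))
              , inc-dec η j eq)

      -- Testing stationarity of ρ = f · weight against f itself makes the
      -- Dirichlet form of f vanish, so f is constant along jumps.
      module Uniqueness {M : ℕ} (simplex : ∀ M → Simplex M) (ρ : Vec ℕ (suc n) → Carrier)
        (stationary : ∀ G → Σ[ list (simplex M) ] (λ η → ρ η * generator G η) ≈ 0#) where

        density : Vec ℕ (suc n) → Carrier
        density η = ρ η * recip (weight-pos η)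

        ρ≈weight*density : ∀ η → ρ η ≈ weight η * density η
        ρ≈weight*density η = begin-equality
          ρ η                                      ≈⟨ *-identityʳ _ ⟨
          ρ η * 1#                                 ≈⟨ *-congˡ (recip-inverse (weight-pos η)) ⟨
          ρ η * (weight η * recip (weight-pos η))  ≈⟨ rotate (ρ η) (weight η) (recip (weight-pos η)) ⟩
          weight η * density η                     ∎
          where
          rotate : ∀ a b r → a * (b * r) ≈ b * (a * r)
          rotate = solve 3 (λ a b r → a :* (b :* r) := b :* (a :* r)) refl

        -- A jump requires a particle, so `M` is positive here. For `M` zero, `gather` makes no
        -- transfer and `density-constant` holds trivially.
        module _ {M₁} (M≡ : M ≡ suc M₁) where

          ηs ζs : List (Vec ℕ (suc n))
          ηs = list (simplex M)
          ζs = list (simplex M₁)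

          difference : Vec ℕ (suc n) → Fin (suc n) → Carrier
          difference ζ j = density (inc ζ (next j)) - density (inc ζ j)

          energy current : Vec ℕ (suc n) → Carrier
          energy  ζ = sum λ j → difference ζ j * difference ζ j
          current ζ = sum λ j → density (inc ζ j) * difference ζ j

          hopDifference : Vec ℕ (suc n) → Fin (suc n) → Carrier
          hopDifference η j = density (hop η j) - density η

          hopDifference-inc : ∀ ζ j → hopDifference (inc ζ j) j ≈ difference ζ j
          hopDifference-inc ζ j = +-congʳ (reflexive
            (≡.cong (λ ξ → density (inc ξ (next j))) (dec-inc ζ j)))

          Σ-current-at : ∀ j →
            Σ[ ζs ] (λ ζ → weight ζ * (density (inc ζ j) * difference ζ j))
              ≈ Σ[ ηs ] λ η → ρ η * (departureRate η j * hopDifference η j)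
          Σ-current-at j = begin-equality
            Σ[ ζs ] (λ ζ → weight ζ * (density (inc ζ j) * difference ζ j))
              ≈⟨ Σ-cong ζs (λ {ζ} _ → *-congˡ (*-congˡ (hopDifference-inc ζ j))) ⟨
            Σ[ ζs ] (λ ζ → weight ζ * (density (inc ζ j) * hopDifference (inc ζ j) j))
              ≈⟨ Σ-departures (simplex M) (simplex M₁) M≡ j (λ η → density η * hopDifference η j) ⟨
            Σ[ ηs ] (λ η → weight η * departureRate η j * (density η * hopDifference η j))
              ≈⟨ Σ-cong ηs (λ {η} _ → trans
                   (rearrange (weight η) (departureRate η j) (density η) (hopDifference η j))
                   (*-congʳ (sym (ρ≈weight*density η)))) ⟩
            Σ[ ηs ] (λ η → ρ η * (departureRate η j * hopDifference η j)) ∎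
            where
            rearrange : ∀ w d f g → w * d * (f * g) ≈ w * f * (d * g)
            rearrange = solve 4 (λ w d f g → w :* d :* (f :* g) := w :* f :* (d :* g)) refl

          -- The substitution differs from site to site, so the sum over `j` is first moved outside.
          -- What results is the stationarity of `ρ` tested against its own density.
          Σ-current : Σ[ ζs ] (λ ζ → weight ζ * current ζ) ≈ 0#
          Σ-current = begin-equality
            Σ[ ζs ] (λ ζ → weight ζ * current ζ)
              ≈⟨ Σ-cong ζs (λ {ζ} _ → *-distribˡ-sum (weight ζ) (λ j → density (inc ζ j) * difference ζ j)) ⟩
            Σ[ ζs ] (λ ζ → sum λ j → weight ζ * (density (inc ζ j) * difference ζ j))
              ≈⟨ Σ-sum-comm ζs (λ ζ j → weight ζ * (density (inc ζ j) * difference ζ j)) ⟩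
            sum (λ j → Σ[ ζs ] λ ζ → weight ζ * (density (inc ζ j) * difference ζ j))
              ≈⟨ sum-cong _ (λ j → Σ[ ηs ] λ η → ρ η * (departureRate η j * hopDifference η j)) Σ-current-at ⟩
            sum (λ j → Σ[ ηs ] λ η → ρ η * (departureRate η j * hopDifference η j))
              ≈⟨ Σ-sum-comm ηs (λ η j → ρ η * (departureRate η j * hopDifference η j)) ⟨
            Σ[ ηs ] (λ η → sum λ j → ρ η * (departureRate η j * hopDifference η j))
              ≈⟨ Σ-cong ηs (λ {η} _ → *-distribˡ-sum (ρ η) (λ j → departureRate η j * hopDifference η j)) ⟨
            Σ[ ηs ] (λ η → ρ η * generator density η)
              ≈⟨ stationary density ⟩
            0# ∎

          -- By `cyclic-square`, energy plus twice current is zero for each `ζ`, and the weighted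
          -- currents sum to zero.
          Σ-energy : Σ[ ζs ] (λ ζ → weight ζ * energy ζ) ≈ 0#
          Σ-energy = begin-equality
            E                      ≈⟨ +-identityʳ E ⟨
            E + 0#                 ≈⟨ +-congˡ (trans (+-cong Σ-current Σ-current) (+-identityʳ 0#)) ⟨
            E + (S + S)            ≈⟨ +-congˡ (Σ-+ ζs current′ current′) ⟨
            E + Σ[ ζs ] (λ ζ → current′ ζ + current′ ζ)
                                   ≈⟨ Σ-+ ζs energy′ (λ ζ → current′ ζ + current′ ζ) ⟨
            Σ[ ζs ] (λ ζ → energy′ ζ + (current′ ζ + current′ ζ))
                                   ≈⟨ Σ-zero ζs (λ {ζ} _ → trans
                                        (factor (weight ζ) (energy ζ) (current ζ))
                                        (trans (*-congˡ (cyclic-square (λ j → density (inc ζ j)))) (zeroʳ _))) ⟩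
            0#                     ∎
            where
            energy′ current′ : Vec ℕ (suc n) → Carrier
            energy′  ζ = weight ζ * energy ζ
            current′ ζ = weight ζ * current ζ
            E = Σ[ ζs ] energy′
            S = Σ[ ζs ] current′
            factor : ∀ w e s → w * e + (w * s + w * s) ≈ w * (e + (s + s))
            factor = solve 3 (λ w e s → w :* e :+ (w :* s :+ w :* s) := w :* (e :+ (s :+ s))) refl

          density-next : ∀ {ζ} → ζ ∈ ζs → ∀ j → density (inc ζ (next j)) ≈ density (inc ζ j)
          density-next {ζ} ζ∈ j = x∙y⁻¹≈ε⇒x≈y _ _ (square≈0⇒≈0 (sum-nonneg≈0
            {f = λ j → difference ζ j * difference ζ j} (λ j → square-nonneg (difference ζ j))
            (*-cancelˡ-≈0 (weight-pos ζ) (Σ-nonneg≈0 {f = λ ζ → weight ζ * energy ζ}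
              (λ ζ → *-nonneg (<⇒≤ (weight-pos ζ))
                (sum-nonneg {f = λ j → difference ζ j * difference ζ j} λ j → square-nonneg (difference ζ j)))
              Σ-energy ζ∈)) j))

          density-inc : ∀ {ζ} → ζ ∈ ζs → ∀ j → density (inc ζ j) ≈ density (inc ζ zero)
          density-inc {ζ} ζ∈ = FinInduction.<-weakInduction
            (λ j → density (inc ζ j) ≈ density (inc ζ zero)) refl
            (λ j eq → trans (reflexive (≡.cong (density ∘ inc ζ) (≡.sym (next-inject₁ j))))
                            (trans (density-next ζ∈ (inject₁ j)) eq))

        density-constant : ∀ {η} → Vec.sum η ≡ M → density η ≈ density (M ∷ Vec.replicate n 0)
        density-constant {a ∷ v} = gather M (λ a v → density (a ∷ v))
          -- With `ζ = a ∷ v`, both ends of the transfer are definitionally increments of `ζ`, at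
          -- the sites `suc i` and `zero`.
          (λ a v i eq → density-inc (≡.trans (≡.sym eq) (ℕₚ.+-suc a _)) (⇒∈ (simplex _) ≡.refl) (suc i))
          a v

        ρ≈ : ∀ {η} → η ∈ list (simplex M) → ρ η ≈ density (M ∷ Vec.replicate n 0) * weight η
        ρ≈ {η} η∈ = trans (ρ≈weight*density η)
          (trans (*-congˡ (density-constant (∈⇒ (simplex M) η∈))) (*-comm _ _))

-- Lumping species

module Lumping {c ℓ₁ ℓ₂} (R : RealField c ℓ₁ ℓ₂) where
  open Reals R
  open RealField R hiding (Carrier; _≈_; _<_; _*_; 0#; zero)
  open IntegerSolver commutativeRing
  open Algebra.Properties.Semiring.Mult semiring using (×-comm-*; ×-congʳ)
  open OrderedField R
  open Occupation
  open FiniteSums R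
  open Weights R
  open ≤-Reasoning

  module _ {t : Carrier} (t>0 : 0# < t) {n k : ℕ} {x : Vector Carrier (suc n)} (x>0 : Positive x) where
    open TAnalogues t>0
    open TAZRP {n} {k} x>0
    open SingleSpecies t>0 x>0

    private
      C = Config (suc n) k

      _≟ᶜ_ : DecidableEquality C
      _≟ᶜ_ = Vecₚ.≡-dec _≟ᵐ_

    ⋃ᵐ-jump : ∀ (c : C) j r {a} → count c j r ≡ suc a → ⋃ᵐ (jump c j r) ≡ ⋃ᵐ c
    ⋃ᵐ-jump c j r eq = ≡.trans (⋃ᵐ-add (remove c j r) (next j) r)
      (≡.trans (≡.sym (⋃ᵐ-add (remove c j r) j r)) (≡.cong ⋃ᵐ (add-remove c j r eq)))

    lump-jump-true : ∀ i (c : C) j r {a} → count c j r ≡ suc a → reaches i r ≡ true →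
                     lump i (jump c j r) ≡ hop (lump i c) j
    lump-jump-true i c j r eq b = ≡.trans (lump-add-true i (remove c j r) (next j) r b)
      (≡.cong (λ ζ → inc ζ (next j))
        (≡.trans (≡.sym (dec-inc (lump i (remove c j r)) j))
          (≡.cong (λ η → dec η j) (≡.trans (≡.sym (lump-add-true i (remove c j r) j r b))
            (≡.cong (lump i) (add-remove c j r eq))))))

    lump-jump-false : ∀ i (c : C) j r {a} → count c j r ≡ suc a → reaches i r ≡ false →
                      lump i (jump c j r) ≡ lump i c
    lump-jump-false i c j r eq b = ≡.trans (lump-add-false i (remove c j r) (next j) r b)
      (≡.trans (≡.sym (lump-add-false i (remove c j r) j r b)) (≡.cong (lump i) (add-remove c j r eq)))

    jumpRate-zero : ∀ (c : C) j r → count c j r ≡ 0 → jumpRate c j r ≈ 0#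
    jumpRate-zero c j r eq = trans (*-congˡ (reflexive (≡.cong [_]ₜ eq))) (zeroʳ _)

    -- Jumps of the species below i leave the lumped configuration unchanged.
    lumped-generator : ∀ i (G : Vec ℕ (suc n) → Carrier) (c : C) →
      sum (λ j → sum λ r → jumpRate c j r * (G (lump i (jump c j r)) - G (lump i c)))
        ≈ generator G (lump i c)
    lumped-generator i G c = sum-cong
      (λ j → sum λ r → jumpRate c j r * (G (lump i (jump c j r)) - G (lump i c)))
      (λ j → departureRate (lump i c) j * Δ j) site
      where
      Δ : Fin (suc n) → Carrier
      Δ j = G (hop (lump i c) j) - G (lump i c)

      speciesRate : Fin (suc n) → Fin k → Carrier
      speciesRate j r = when t>0 (reaches i r) (t ^ larger c j r * [ count c j r ]ₜ)

      -- For an absent species `pred` truncates and `jump` would create a particle. Its rate is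
      -- zero, so these cases are settled without looking at the target.
      term : ∀ j r a b → count c j r ≡ a → reaches i r ≡ b →
        jumpRate c j r * (G (lump i (jump c j r)) - G (lump i c))
          ≈ recip (x>0 j) * when t>0 b (t ^ larger c j r * [ count c j r ]ₜ) * Δ j
      term j r zero true ca rb = trans (trans (*-congʳ (jumpRate-zero c j r ca)) (zeroˡ _))
        (sym (trans (*-congʳ (trans (sym (*-assoc _ _ _)) (jumpRate-zero c j r ca))) (zeroˡ _)))
      term j r zero false ca rb = trans (trans (*-congʳ (jumpRate-zero c j r ca)) (zeroˡ _))
        (sym (trans (*-congʳ (zeroʳ _)) (zeroˡ _)))
      term j r (suc a) true ca rb = *-cong (*-assoc _ _ _)
        (+-congʳ (reflexive (≡.cong G (lump-jump-true i c j r ca rb))))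
      term j r (suc a) false ca rb = trans
        (*-congˡ (trans (+-congʳ (reflexive (≡.cong G (lump-jump-false i c j r ca rb)))) (-‿inverseʳ _)))
        (trans (zeroʳ _) (sym (trans (*-congʳ (zeroʳ _)) (zeroˡ _))))

      site : ∀ j → sum (λ r → jumpRate c j r * (G (lump i (jump c j r)) - G (lump i c)))
                   ≈ departureRate (lump i c) j * Δ j
      site j = begin-equality
        sum (λ r → jumpRate c j r * (G (lump i (jump c j r)) - G (lump i c)))
          ≈⟨ sum-cong _ (λ r → recip (x>0 j) * speciesRate j r * Δ j)
               (λ r → term j r (count c j r) (reaches i r) ≡.refl ≡.refl) ⟩
        sum (λ r → recip (x>0 j) * speciesRate j r * Δ j)
          ≈⟨ *-distribʳ-sum (Δ j) (λ r → recip (x>0 j) * speciesRate j r) ⟨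
        sum (λ r → recip (x>0 j) * speciesRate j r) * Δ j
          ≈⟨ *-congʳ (*-distribˡ-sum (recip (x>0 j)) (speciesRate j)) ⟨
        recip (x>0 j) * sum (speciesRate j) * Δ j
          ≈⟨ *-congʳ (*-congˡ (lumped-rate t>0 (lookup c j) i)) ⟩
        recip (x>0 j) * [ atLeast (lookup c j) i ]ₜ * Δ j
          ≈⟨ *-congʳ (*-congˡ (reflexive (≡.cong [_]ₜ (Vecₚ.lookup-map j (λ u → atLeast u i) c)))) ⟨
        departureRate (lump i c) j * Δ j ∎

    module _ {m : Multiset k} (S : Enumeration λ (c : C) → ⋃ᵐ c ≡ m)
             {π : C → Carrier} (stationary : IsStationary (list S) rate π) where
      open IsStationary stationary

      -- Summing over targets removes the indicators in `rate`, also when several jumps share a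
      -- target. The target of a jump with a particle present is in the list because the species
      -- content is conserved.
      Σ-rate : ∀ {c} → c ∈ list S → ∀ (g : C → Carrier) →
        Σ[ list S ] (λ c′ → rate c c′ * g c′) ≈ sum λ j → sum λ r → jumpRate c j r * g (jump c j r)
      Σ-rate {c} c∈ g = begin-equality
        Σ[ list S ] (λ c′ → rate c c′ * g c′)
          ≈⟨ Σ-cong (list S) (λ {c′} _ → trans (*-distribʳ-sum (g c′) (λ j → sum λ r → rate-at c′ j r))
               (sum-cong _ (λ j → sum λ r → rate-at c′ j r * g c′) λ j → *-distribʳ-sum (g c′) (rate-at c′ j))) ⟩
        Σ[ list S ] (λ c′ → sum λ j → sum λ r → rate-at c′ j r * g c′)
          ≈⟨ Σ-sum-comm (list S) (λ c′ j → sum λ r → rate-at c′ j r * g c′) ⟩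
        sum (λ j → Σ[ list S ] λ c′ → sum λ r → rate-at c′ j r * g c′)
          ≈⟨ sum-cong _ (λ j → sum λ r → jumpRate c j r * g (jump c j r)) (λ j →
               trans (Σ-sum-comm (list S) (λ c′ r → rate-at c′ j r * g c′))
                     (sum-cong _ (λ r → jumpRate c j r * g (jump c j r)) λ r → term j r (count c j r) ≡.refl)) ⟩
        sum (λ j → sum λ r → jumpRate c j r * g (jump c j r)) ∎
        where
        rate-at : C → Fin (suc n) → Fin k → Carrier
        rate-at c′ j r = if does (jump c j r ≟ᶜ c′) then jumpRate c j r else 0#

        if-zero : ∀ b {a} → a ≈ 0# → (if b then a else 0#) ≈ 0#
        if-zero true  a≈0 = a≈0
        if-zero false a≈0 = refl

        term : ∀ j r a → count c j r ≡ a →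
          Σ[ list S ] (λ c′ → rate-at c′ j r * g c′) ≈ jumpRate c j r * g (jump c j r)
        term j r zero eq = trans
          (Σ-zero (list S) λ {c′} _ → trans
            (*-congʳ (if-zero (does (jump c j r ≟ᶜ c′)) (jumpRate-zero c j r eq))) (zeroˡ _))
          (sym (trans (*-congʳ (jumpRate-zero c j r eq)) (zeroˡ _)))
        term j r (suc a) eq = trans
          (Σ-isolate {f = λ c′ → rate-at c′ j r * g c′} (unique S)
            (⇒∈ S (≡.trans (⋃ᵐ-jump c j r eq) (∈⇒ S c∈)))
            λ {c′} _ ≢c′ → trans (*-congʳ (reflexive (if-no (jump c j r ≟ᶜ c′) ≢c′))) (zeroˡ _))
          (*-congʳ (reflexive (if-yes (jump c j r ≟ᶜ jump c j r) ≡.refl)))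

      -- This is the balance equation integrated against `g`: `X` is the total inflow and `Y` the
      -- total outflow, each weighted by `g` at the configuration concerned.
      stationary-test : ∀ (g : C → Carrier) →
        Σ[ list S ] (λ c → π c * sum λ j → sum λ r → jumpRate c j r * (g (jump c j r) - g c)) ≈ 0#
      stationary-test g = begin-equality
        Σ[ list S ] (λ c → π c * sum λ j → sum λ r → jumpRate c j r * (g (jump c j r) - g c))
          ≈⟨ Σ-cong (list S) (λ {c} c∈ → *-congˡ (Σ-rate c∈ (λ c′ → g c′ - g c))) ⟨
        D               ≈⟨ solve 2 (λ d y → d := d :+ y :- y) refl D Y ⟩
        D + Y - Y       ≈⟨ +-congʳ (trans D+Y≈X X≈Y) ⟩
        Y - Y           ≈⟨ -‿inverseʳ Y ⟩
        0#              ∎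
        where
        X Y D : Carrier
        X = Σ[ list S ] λ c → Σ[ list S ] λ c′ → π c * rate c c′ * g c′
        Y = Σ[ list S ] λ c → Σ[ list S ] λ c′ → π c * rate c c′ * g c
        D = Σ[ list S ] λ c → π c * Σ[ list S ] λ c′ → rate c c′ * (g c′ - g c)

        expand : ∀ p q u v → p * (q * (u - v)) + p * q * v ≈ p * q * u
        expand = solve 4 (λ p q u v → p :* (q :* (u :- v)) :+ p :* q :* v := p :* q :* u) refl

        D+Y≈X : D + Y ≈ X
        D+Y≈X = trans (sym (Σ-+ (list S) _ (λ c → Σ[ list S ] λ c′ → π c * rate c c′ * g c)))
          (Σ-cong (list S) λ {c} _ → trans
            (+-congʳ (Σ-*ˡ (π c) (list S) (λ c′ → rate c c′ * (g c′ - g c))))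
            (trans (sym (Σ-+ (list S) (λ c′ → π c * (rate c c′ * (g c′ - g c))) (λ c′ → π c * rate c c′ * g c)))
              (Σ-cong (list S) λ {c′} _ → expand (π c) (rate c c′) (g c′) (g c))))

        X≈Y : X ≈ Y
        X≈Y = begin-equality
          X
            ≈⟨ Σ-comm (list S) (list S) (λ c c′ → π c * rate c c′ * g c′) ⟩
          Σ[ list S ] (λ c′ → Σ[ list S ] λ c → π c * rate c c′ * g c′)
            ≈⟨ Σ-cong (list S) (λ {c′} _ → Σ-*ʳ (g c′) (list S) (λ c → π c * rate c c′)) ⟨
          Σ[ list S ] (λ c′ → (Σ[ list S ] λ c → π c * rate c c′) * g c′)
            ≈⟨ Σ-cong (list S) (λ {c′} c′∈ → *-congʳ (balance c′∈)) ⟩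
          Σ[ list S ] (λ c → (π c * Σ[ list S ] λ c′ → rate c c′) * g c)
            ≈⟨ Σ-cong (list S) (λ {c} _ → trans
                 (*-congʳ (Σ-*ˡ (π c) (list S) (rate c))) (Σ-*ʳ (g c) (list S) (λ c′ → π c * rate c c′))) ⟩
          Y ∎

      module _ (i : Fin (suc k)) (simplex : ∀ M → Simplex M) where

        private
          M = atLeast m i
          ηs = list (simplex M)

          _≟_ : DecidableEquality (Vec ℕ (suc n))
          _≟_ = Vecₚ.≡-dec ℕₚ._≟_

        pushforward : Vec ℕ (suc n) → Carrier
        pushforward η = Σ[ list S ] λ c → if does (lump i c ≟ η) then π c else 0#

        Σ-pushforward : ∀ (h : Vec ℕ (suc n) → Carrier) →
          Σ[ list S ] (λ c → π c * h (lump i c)) ≈ Σ[ ηs ] λ η → pushforward η * h η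
        Σ-pushforward h = begin-equality
          Σ[ list S ] (λ c → π c * h (lump i c))
            ≈⟨ Σ-cong (list S) (λ {c} c∈ → trans
                 (Σ-isolate {f = λ η → mass c η * h η} (unique (simplex M))
                   (⇒∈ (simplex M) (≡.trans (sum-lump i c) (≡.cong (λ u → atLeast u i) (∈⇒ S c∈))))
                   λ {η} _ ≢η → trans (*-congʳ (reflexive (if-no (lump i c ≟ η) ≢η))) (zeroˡ _))
                 (*-congʳ (reflexive (if-yes (lump i c ≟ lump i c) ≡.refl)))) ⟨
          Σ[ list S ] (λ c → Σ[ ηs ] λ η → mass c η * h η)
            ≈⟨ Σ-comm (list S) ηs (λ c η → mass c η * h η) ⟩
          Σ[ ηs ] (λ η → Σ[ list S ] λ c → mass c η * h η)
            ≈⟨ Σ-cong ηs (λ {η} _ → Σ-*ʳ (h η) (list S) (λ c → mass c η)) ⟨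
          Σ[ ηs ] (λ η → pushforward η * h η) ∎
          where
          mass : C → Vec ℕ (suc n) → Carrier
          mass c η = if does (lump i c ≟ η) then π c else 0#

        -- On test functions that factor through `lump i`, the generator of the full process acts as
        -- that of the single species process.
        pushforward-stationary : ∀ G → Σ[ ηs ] (λ η → pushforward η * generator G η) ≈ 0#
        pushforward-stationary G = begin-equality
          Σ[ ηs ] (λ η → pushforward η * generator G η)
            ≈⟨ Σ-pushforward (generator G) ⟨
          Σ[ list S ] (λ c → π c * generator G (lump i c))
            ≈⟨ Σ-cong (list S) (λ {c} _ → *-congˡ (lumped-generator i G c)) ⟨
          Σ[ list S ] (λ c → π c * sum λ j → sum λ r → jumpRate c j r * (G (lump i (jump c j r)) - G (lump i c)))
            ≈⟨ stationary-test (G ∘ lump i) ⟩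
          0# ∎

        open Uniqueness simplex pushforward pushforward-stationary using (ρ≈)

        -- The constant is the common value of the density. It stays unspecified because
        -- `lumped-normalised` determines it.
        lumped-expectation : ∃[ A ] (∀ (h : Vec ℕ (suc n) → Carrier) →
          Σ[ list S ] (λ c → π c * h (lump i c)) ≈ A * Σ[ ηs ] λ η → weight η * h η)
        lumped-expectation = _ , λ h → trans (Σ-pushforward h) (trans
          (Σ-cong ηs λ η∈ → trans (*-congʳ (ρ≈ η∈)) (*-assoc _ _ _))
          (sym (Σ-*ˡ _ ηs (λ η → weight η * h η))))

        lumped-normalised : proj₁ lumped-expectation * Σ[ ηs ] weight ≈ 1#
        lumped-normalised = begin-equality
          proj₁ lumped-expectation * Σ[ ηs ] weight
            ≈⟨ *-congˡ (Σ-cong ηs λ _ → *-identityʳ _) ⟨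
          proj₁ lumped-expectation * Σ[ ηs ] (λ η → weight η * 1#)
            ≈⟨ proj₂ lumped-expectation (λ _ → 1#) ⟨
          Σ[ list S ] (λ c → π c * 1#)
            ≈⟨ Σ-cong (list S) (λ _ → *-identityʳ _) ⟩
          Σ[ list S ] π
            ≈⟨ normalised ⟩
          1# ∎

        lumped-mean :
          Σ[ list S ] (λ c → lookup (lump i c) zero · π c)
            ≈ proj₁ lumped-expectation * Σ[ ηs ] λ η → weight η * (lookup η zero · 1#)
        lumped-mean = trans
          (Σ-cong (list S) λ {c} _ → sym (trans
            (×-comm-* (lookup (lump i c) zero) (π c) 1#) (×-congʳ (lookup (lump i c) zero) (*-identityʳ (π c)))))
          (proj₂ lumped-expectation (λ η → lookup η zero · 1#))

-- Stationary means

module Expectations {c ℓ₁ ℓ₂} (R : RealField c ℓ₁ ℓ₂) where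
  open Reals R
  open RealField R hiding (Carrier; _≈_; _<_; _*_; 0#; zero)
  open IntegerSolver commutativeRing
  open Algebra.Properties.Semiring.Mult semiring using (×-comm-*; ×-congʳ; ×-homo-+)
  open OrderedField R
  open Occupation
  open FiniteSums R
  open Calculus R
  open Weights R
  open Lumping R
  open ≤-Reasoning

  product-ones : ∀ {n} {f : Vector Carrier n} → (∀ i → f i ≈ 1#) → product f ≈ 1#
  product-ones {zero}  eq = refl
  product-ones {suc n} eq = trans (*-cong (eq zero) (product-ones (eq ∘ suc))) (*-identityʳ 1#)

  configurations : ∀ n {k} (m : Multiset k) → Enumeration λ (c : Config n k) → ⋃ᵐ c ≡ m
  configurations n m = record { list = configs n m ; unique = configs-unique n m ; ∈⇔ = ∈-configs }

  simplex : ∀ n M → Enumeration λ (η : Vec ℕ n) → Vec.sum η ≡ M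
  simplex n M = record { list = compositions n M ; unique = compositions-unique n M ; ∈⇔ = ∈-compositions }

  module _ {log : Fun} (isLog : IsLog log) {t : Carrier} (t>0 : 0# < t) where
    open IsLog isLog
    open Logarithm isLog
    open TAnalogues t>0
    open SingleSpecies t>0 using (weight)

    weight-∅ : ∀ {n} {x : Vector Carrier (suc n)} (x>0 : Positive x) →
               weight x>0 (Vec.replicate (suc n) 0) ≈ 1#
    weight-∅ {n} {x} x>0 = trans
      (*-cong (trans (sym (*-identityʳ _))
                (recip-*-cancel {q = 1#} 0<1 (product-!-pos (Vec.replicate (suc n) 0))
                  (trans (product-ones {suc n} λ i → reflexive (≡.cong [_]ₜ! (Vecₚ.lookup-replicate i 0)))
                         (sym (*-identityʳ 1#)))))
              (product-ones {suc n} λ i → reflexive (≡.cong (x i ^_) (Vecₚ.lookup-replicate i 0))))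
      (trans (*-comm _ _) (trans (*-identityˡ _) (trans (sym (*-identityˡ _)) (recip-inverse 0<1))))

    Σ-weight-0 : ∀ {n} {x : Vector Carrier (suc n)} (x>0 : Positive x) (E : SingleSpecies.Simplex t>0 x>0 0) →
                 Σ[ list E ] (weight x>0) ≈ 1#
    Σ-weight-0 {n} x>0 E = trans
      (Σ-isolate (unique E) (⇒∈ E (sum-replicate-0 (suc n)))
        λ η∈ ≢η → ⊥-elim (≢η (≡.sym (sum≡0⇒replicate _ (∈⇒ E η∈)))))
      (weight-∅ x>0)

    -- At zero `H̃` is `1#` by definition and not by its sum; the two agree since the only
    -- composition of zero has weight one.
    H̃≈ : ∀ {n} M {x : Vector Carrier (suc n)} (x>0 : Positive x) →
         H̃ M x ≈ [ M ]ₜ! * Σ[ compositions (suc n) M ] (weight x>0)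
    H̃≈ {n} zero x>0 = sym (trans (*-identityˡ _) (Σ-weight-0 x>0 (simplex (suc n) 0)))
    H̃≈ {n} M@(suc _) {x} x>0 = trans
      (Σ-cong (compositions (suc n) M) λ _ → *-assoc _ _ _)
      (sym (Σ-*ˡ [ M ]ₜ! (compositions (suc n) M) (weight x>0)))

    module _ {n : ℕ} {x : Vector Carrier (suc n)} (x>0 : Positive x) where

      along : (y : Carrier) → 0# < y → Positive (x [ zero ≔ y ])
      along y y>0 = ≔-positive zero x>0 y>0

      -- As a function of the first variable the weight is a constant times a power, and the Euler
      -- operator multiplies it by the exponent.
      weight-derivative : ∀ η → ∃[ D ]
        ( HasDerivativeAt (λ y y>0 → weight (along y y>0) η) (x zero) (x>0 zero) D
        × x zero * D ≈ weight x>0 η * (lookup η zero · 1#))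
      weight-derivative (a ∷ η) =
        let r = recip (product-!-pos (a ∷ η))
            X = product λ i → x (suc i) ^ lookup η i
            (D , ∂^ , xD≈) = derivative-^ {x zero} {x>0 zero} a
        in r * (X * D) ,
           derivative-*ˡ {x>0 = x>0 zero} {f = λ y _ → y ^ a * X} r
             (derivative-cong {x>0 = x>0 zero} {f = λ y _ → X * y ^ a} (λ y _ → *-comm X (y ^ a)) refl
               (derivative-*ˡ {x>0 = x>0 zero} {f = λ y _ → y ^ a} X ∂^)) ,
           (begin-equality
             x zero * (r * (X * D))            ≈⟨ pull (x zero) r X D ⟩
             r * (X * (x zero * D))            ≈⟨ *-congˡ (*-congˡ (trans xD≈ (×-congʳ a (sym (*-identityʳ _))))) ⟩
             r * (X * (a · (x zero ^ a * 1#))) ≈⟨ *-congˡ (*-congˡ (×-comm-* a (x zero ^ a) 1#)) ⟨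
             r * (X * (x zero ^ a * (a · 1#))) ≈⟨ regroup r X (x zero ^ a) (a · 1#) ⟩
             r * (x zero ^ a * X) * (a · 1#)   ∎)
        where
        pull : ∀ p r X D → p * (r * (X * D)) ≈ r * (X * (p * D))
        pull = solve 4 (λ p r X D → p :* (r :* (X :* D)) := r :* (X :* (p :* D))) refl
        regroup : ∀ r X p q → r * (X * (p * q)) ≈ r * (p * X) * q
        regroup = solve 4 (λ r X p q → r :* (X :* (p :* q)) := r :* (p :* X) :* q) refl

      logH̃ : ℕ → Fun
      logH̃ M y y>0 = log (H̃ M (x [ zero ≔ y ])) (H̃-pos M (along y y>0))

      module _ (M : ℕ) where

        private
          ηs = compositions (suc n) M
          H = H̃ M (x [ zero ≔ x zero ])
          H>0 : 0# < H
          H>0 = H̃-pos M (along (x zero) (x>0 zero))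

        logH̃′ : Carrier
        logH̃′ = recip H>0 * ([ M ]ₜ! * Σ[ ηs ] λ η → proj₁ (weight-derivative η))

        logH̃-derivative : HasDerivativeAt (logH̃ M) (x zero) (x>0 zero) logH̃′
        logH̃-derivative = derivative-∘ {L = log} (λ y y>0 → H̃-pos M (along y y>0))
          (log-derivative H H>0)
          (derivative-cong {x>0 = x>0 zero} {f = λ y y>0 → [ M ]ₜ! * Σ[ ηs ] (weight (along y y>0))}
            (λ y y>0 → sym (H̃≈ M (along y y>0))) refl
            (derivative-*ˡ {x>0 = x>0 zero} {f = λ y y>0 → Σ[ ηs ] (weight (along y y>0))} [ M ]ₜ!
              (derivative-Σ {x>0 = x>0 zero} ηs {f = λ η y y>0 → weight (along y y>0) η}
                λ η → proj₁ (proj₂ (weight-derivative η)))))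

        -- `H̃` is `[ M ]ₜ!` times the total weight, so `A` must be `[ M ]ₜ!` divided by `H̃`. The
        -- left side is then the Euler operator applied to `H̃`, divided by `H̃`.
        mean-from-normalisation : ∀ {A} → A * Σ[ ηs ] (weight x>0) ≈ 1# →
          A * Σ[ ηs ] (λ η → weight x>0 η * (lookup η zero · 1#)) ≈ x zero * logH̃′
        mean-from-normalisation {A} AZ≈1 = begin-equality
          A * W                                              ≈⟨ *-congʳ A≈ ⟩
          recip H>0 * F * W                                  ≈⟨ *-assoc _ _ _ ⟩
          recip H>0 * (F * W)
            ≈⟨ *-congˡ (*-congˡ (Σ-cong ηs λ {η} _ → proj₂ (proj₂ (weight-derivative η)))) ⟨
          recip H>0 * (F * Σ[ ηs ] λ η → x zero * proj₁ (weight-derivative η))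
            ≈⟨ *-congˡ (*-congˡ (Σ-*ˡ (x zero) ηs λ η → proj₁ (weight-derivative η))) ⟨
          recip H>0 * (F * (x zero * W′))                    ≈⟨ pull (recip H>0) F (x zero) W′ ⟩
          x zero * logH̃′                                     ∎
          where
          F W W′ Z : Carrier
          F = [ M ]ₜ!
          W = Σ[ ηs ] λ η → weight x>0 η * (lookup η zero · 1#)
          W′ = Σ[ ηs ] λ η → proj₁ (weight-derivative η)
          Z = Σ[ ηs ] (weight x>0)

          pull : ∀ r f p w → r * (f * (p * w)) ≈ p * (r * (f * w))
          pull = solve 4 (λ r f p w → r :* (f :* (p :* w)) := p :* (r :* (f :* w))) refl

          A≈ : A ≈ recip H>0 * F
          A≈ = begin-equality
            A                        ≈⟨ *-identityʳ A ⟨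
            A * 1#                   ≈⟨ *-congˡ (recip-inverse H>0) ⟨
            -- Replacing the first coordinate by its own value leaves every weight definitionally
            -- unchanged, so the sum produced here is already `Z`.
            A * (H * recip H>0)      ≈⟨ *-congˡ (*-congʳ (H̃≈ M (along (x zero) (x>0 zero)))) ⟩
            A * (F * Z * recip H>0)  ≈⟨ rotate A F Z (recip H>0) ⟩
            A * Z * (recip H>0 * F)  ≈⟨ *-congʳ AZ≈1 ⟩
            1# * (recip H>0 * F)     ≈⟨ *-identityˡ _ ⟩
            recip H>0 * F            ∎
            where
            rotate : ∀ a f z r → a * (f * z * r) ≈ a * z * (r * f)
            rotate = solve 4 (λ a f z r → a :* (f :* z :* r) := a :* z :* (r :* f)) refl

      module _ {k : ℕ} (m : Multiset k) {π : Config (suc n) k → Carrier}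
               (stationary : TAZRP.IsStationaryTAZRP x>0 m π) where
        open TAZRP {n} {k} x>0 hiding (IsStationaryTAZRP)

        private
          S = configurations (suc n) m

        lumped-expectation≈ : ∀ i →
          expectation m π (λ c → lookup (lump i c) zero) ≈ x zero * logH̃′ (atLeast m i)
        lumped-expectation≈ i = trans
          (lumped-mean t>0 x>0 S stationary i (simplex (suc n)))
          (mean-from-normalisation (atLeast m i)
            (lumped-normalised t>0 x>0 S stationary i (simplex (suc n))))

        expectation-count : ∀ j →
          expectation m π (λ c → count c zero j)
            ≈ x zero * (logH̃′ (atLeast m (inject₁ j)) - logH̃′ (atLeast m (suc j)))
        expectation-count j = begin-equality
          E                          ≈⟨ solve 2 (λ e u → e := e :+ u :- u) refl E U ⟩
          E + U - U                  ≈⟨ +-congʳ E+U≈V ⟩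
          V - U                      ≈⟨ +-cong (lumped-expectation≈ (inject₁ j)) (-‿cong (lumped-expectation≈ (suc j))) ⟩
          x zero * D - x zero * D′   ≈⟨ solve 3 (λ x d e → x :* d :- x :* e := x :* (d :- e)) refl (x zero) D D′ ⟩
          x zero * (D - D′)          ∎
          where
          E U V D D′ : Carrier
          E  = expectation m π (λ c → count c zero j)
          U  = expectation m π (λ c → lookup (lump (suc j) c) zero)
          V  = expectation m π (λ c → lookup (lump (inject₁ j) c) zero)
          D  = logH̃′ (atLeast m (inject₁ j))
          D′ = logH̃′ (atLeast m (suc j))

          counts : ∀ (c : Config (suc n) k) →
            count c zero j ℕ.+ lookup (lump (suc j) c) zero ≡ lookup (lump (inject₁ j) c) zero
          counts (u ∷ c) = lookup+atLeast u j

          E+U≈V : E + U ≈ V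
          E+U≈V = trans (sym (Σ-+ (list S) (λ c → count c zero j · π c) (λ c → lookup (lump (suc j) c) zero · π c)))
            (Σ-cong (list S) λ {c} _ → trans
              (sym (×-homo-+ (π c) (count c zero j) (lookup (lump (suc j) c) zero)))
              (reflexive (≡.cong (_· π c) (counts c))))

theorem7 :
    ∀ {c ℓ₁ ℓ₂ : Level} (R : RealField c ℓ₁ ℓ₂) →
    let open Reals R in
    (log : ∀ x → 0# < x → Carrier) → IsLog log →
    ∀ (n k : ℕ) (m : Vec ℕ k) → All (0 ℕ.<_) m →
    (x : Vector Carrier (suc n)) (x>0 : Positive x) →
    (t : Carrier) (t>0 : 0# < t) →
    let open TAnalogues t>0
        open TAZRP {n} {k} x>0
    in
    (π : Config (suc n) k → Carrier) → IsStationaryTAZRP m π →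
    (j : Fin k) →
    let M  = atLeast m (inject₁ j)
        M′ = atLeast m (suc j)
    in
    ∃[ D ] (HasPartialDerivativeAt
              (λ y y>0 → log (H̃-ratio M M′ y y>0) (H̃-ratio-pos M M′ y>0))
              zero x x>0 D
          × expectation m π (λ c → count c zero j) ≈ x zero * D)
theorem7 R log isLog n k m _ x x>0 t t>0 π stationary j =
  logH̃′ isLog t>0 x>0 M - logH̃′ isLog t>0 x>0 M′ ,
  -- The logarithm of the ratio splits at every point of the line through `x` in the first
  -- direction, so its derivative is that of the difference. For the largest species `M′` is zero,
  -- where `H̃` is `1#`.
  derivative-cong
    (λ y y>0 → sym (log-quotient (H̃-pos M (≔-positive zero x>0 y>0)) (H̃-pos M′ (≔-positive zero x>0 y>0))))
    refl
    (derivative-sub (logH̃-derivative isLog t>0 x>0 M) (logH̃-derivative isLog t>0 x>0 M′)) ,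
  expectation-count isLog t>0 x>0 m stationary j
  where
  open RealField R using (sym; refl; _-_)
  open Reals R
  open TAnalogues t>0
  open Calculus R
  open Logarithm isLog
  open Expectations R
  M  = atLeast m (inject₁ j)
  M′ = atLeast m (suc j)
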